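{- For every integer $n\ge 1$, the number of collapsed permutations in $S_{2n+1}$ equals the Genocchi number of the first kind $g_{2n+4}$.
   Context: A permutation $\pi\in S_N$ is collapsed if for every $k\in[N]$, $\pi^{ -1}(k)\ge \lceil k/2\rceil$ when $N$ is odd (resp. $\pi^{ -1}(k)\ge 1+\lfloor k/2\rfloor$ when $N$ is even), and $\pi^{ -1}(k)\le \lceil N/2\rceil+\lfloor k/2\rfloor$. The (unsigned) Genocchi numbers of the first kind $g_{2n}$ are defined by $\sum_{n\ge 0} g_{2n}\,\frac{x^{2n}}{(2n)!}=x\tan(x/2)$; thus $g_2=1,g_4=1,g_6=3,g_8=17,g_{10}=155,\dots$. -}

module Defs where

open import Data.Nat as ℕ using (ℕ; zero; suc; _≤_; _+_; _*_; _^_; ⌊_/2⌋; ⌈_/2⌉)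
open import Data.Nat.Combinatorics using ()
open import Data.Nat.Base using (_!)
open import Data.Fin using (Fin; toℕ)
open import Data.Fin.Properties using (all?)
open import Data.Vec using (Vec; []; _∷_; lookup)
open import Data.List using (List; []; _∷_; length; filter; map; concatMap; sum; zipWith)
open import Data.Product using (_×_)
open import Data.Integer using (+_)
open import Data.Rational using (ℚ; _/_; 0ℚ; 1ℚ; -_) renaming (_+_ to _+q_; _*_ to _*q_; _-_ to _-q_)
open import Data.Rational.Properties using ()
open import Relation.Binary.PropositionalEquality using (_≡_)
open import Relation.Nullary using (Dec; yes; no; _×-dec_)
open import Relation.Nullary.Decidable using (_→-dec_)
import Data.Fin.Properties as FinP
import Data.Nat.Properties as NatP

-- Permutations of [N] in one-line notation.
-- A vector π : Vec (Fin N) N represents the map i ↦ lookup π i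
-- (positions and values are 0-indexed Fin N; the paper's 1-indexed
-- position / value is toℕ + 1).

IsPerm : ∀ {N} → Vec (Fin N) N → Set
IsPerm {N} π = ∀ (i j : Fin N) → lookup π i ≡ lookup π j → i ≡ j

isPerm? : ∀ {N} (π : Vec (Fin N) N) → Dec (IsPerm π)
isPerm? π = all? λ i → all? λ j → (lookup π i FinP.≟ lookup π j) →-dec (i FinP.≟ j)

-- Lower bound on π⁻¹(k) (k 1-indexed), depending on the parity of N.
lowerBound : ℕ → ℕ → ℕ
lowerBound N k with N ℕ.% 2
... | 1 = ⌈ k /2⌉
... | _ = suc ⌊ k /2⌋

-- Collapsed: for every value k ∈ [N], with p = π⁻¹(k) (1-indexed),
--   lowerBound N k ≤ p ≤ ⌈N/2⌉ + ⌊k/2⌋.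
-- Since π is a bijection, quantifying over values k and taking
-- p = π⁻¹(k) is the same as quantifying over positions p and taking
-- k = π(p); we state it in the latter form (p = toℕ i + 1, k = toℕ (π i) + 1).
Collapsed : ∀ {N} → Vec (Fin N) N → Set
Collapsed {N} π = ∀ (i : Fin N) →
  (lowerBound N (suc (toℕ (lookup π i))) ≤ suc (toℕ i)) ×
  (suc (toℕ i) ≤ ⌈ N /2⌉ + ⌊ suc (toℕ (lookup π i)) /2⌋)

collapsed? : ∀ {N} (π : Vec (Fin N) N) → Dec (Collapsed π)
collapsed? {N} π = all? λ i →
  (lowerBound N (suc (toℕ (lookup π i))) ℕ.≤? suc (toℕ i)) ×-dec
  (suc (toℕ i) ℕ.≤? ⌈ N /2⌉ + ⌊ suc (toℕ (lookup π i)) /2⌋)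

allVecs : (N m : ℕ) → List (Vec (Fin N) m)
allVecs N zero = [] ∷ []
allVecs N (suc m) =
  concatMap (λ v → map (λ x → x ∷ v) (Data.List.allFin N)) (allVecs N m)
  where import Data.List

numCollapsed : ℕ → ℕ
numCollapsed N =
  length (filter (λ π → isPerm? π ×-dec collapsed? π) (allVecs N N))

-- Genocchi numbers of the first kind via the exponential generating
-- function x tan(x/2), computed as formal power series over ℚ.

-- 1 / n as a rational (with 1/0 := 0; only used for n > 0).
inv : ℕ → ℚ
inv zero = 0ℚ
inv (suc n) = + 1 / suc n

-- coefficient of x^k in sin(x/2) and cos(x/2)
sinHalf : ℕ → ℚ
sinHalf k with k ℕ.% 4
... | 1 = inv (2 ^ k * k !)
... | 3 = - inv (2 ^ k * k !)
... | _ = 0ℚ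

cosHalf : ℕ → ℚ
cosHalf k with k ℕ.% 4
... | 0 = inv (2 ^ k * k !)
... | 2 = - inv (2 ^ k * k !)
... | _ = 0ℚ

-- Formal power series quotient S / C for a series C with constant
-- term 1: T_k = S_k - Σ_{i=1..k} C_i T_{k-i}.
-- quotRev S C k = [T_k, T_{k-1}, …, T_0].
quotRev : (ℕ → ℚ) → (ℕ → ℚ) → ℕ → List ℚ
quotRev S C zero = S 0 ∷ []
quotRev S C (suc k) =
  (S (suc k) -q sumq (zipWith _*q_ (Data.List.map (λ j → C (suc j)) (Data.List.upTo (suc k))) prev)) ∷ prev
  where
  import Data.List
  prev = quotRev S C k
  sumq : List ℚ → ℚ
  sumq = Data.List.foldr _+q_ 0ℚ

headq : List ℚ → ℚ
headq [] = 0ℚ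
headq (x ∷ _) = x

tanHalf : ℕ → ℚ
tanHalf k = headq (quotRev sinHalf cosHalf k)

xTanHalf : ℕ → ℚ
xTanHalf zero = 0ℚ
xTanHalf (suc k) = tanHalf k

-- g_m = m! · [x^m] x tan(x/2)   (nonzero only for even m ≥ 2)
genocchi : ℕ → ℚ
genocchi m = (+ (m !) / 1) *q xTanHalf m

{-# OPTIONS --safe #-}
module Submission where

-- Count placements: in a collapsed permutation of [2n+1] the positions p ≤ n take values in
-- [1, 2p], the middle position is unrestricted, and the position n+1+q takes values in the
-- complement of [1, 2q-1].  Expanding the complements turns all rows into nested initial
-- segments, whose permanents are products, and gives the alternating sum
-- Σⱼ (-1)ⁿ⁺¹⁻ʲ (j!)² T(n+1, j), with T the central factorial numbers.
--
-- Up to sign this is L(yⁿ⁺¹) for the linear functional L with L(∏_{i<j} (y - i²)) = (-1)ʲ (j!)².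
-- The relation cos(x/2) · tan(x/2) = sin(x/2) on coefficients says that the functional
-- x²q(x²) ↦ L(q), extended by 0 to constants and odd powers, sends (1 + 2x)²ᴹ to 4M.  This is
-- proved by expanding z²ᴹ, z = 1 + 2x, in the products ∏_{i<J} (z² - (2i+1)²).

open import Defs
open import Data.Nat as ℕ using (ℕ; zero; suc; _≤_; _<_; z≤n; s≤s; ⌊_/2⌋; ⌈_/2⌉)
open import Data.Nat.Base using (_!)
import Data.Nat.Properties as ℕP
open import Data.Integer using (ℤ; +_; 0ℤ; 1ℤ; -1ℤ; _+_; _*_; -_; _-_; _^_)
import Data.Integer.Properties as ℤP
open import Data.Integer.Tactic.RingSolver using (solve; solve-∀)
open import Data.Rational as ℚ using (ℚ; _/_; 0ℚ; 1ℚ)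
import Data.Rational.Properties as ℚP
open import Data.Rational.Solver using (module +-*-Solver)
open import Data.Rational.Unnormalised using (mkℚᵘ; *≡*)
import Data.Rational.Unnormalised.Properties as ℚᵘP
open import Data.Bool using (if_then_else_)
open import Data.Fin using (Fin; zero; suc; toℕ; fromℕ<)
import Data.Fin.Properties as FinP
open import Data.List
  using (List; []; _∷_; _++_; map; concatMap; filter; length; replicate; foldr; zipWith;
         applyUpTo; applyDownFrom; upTo; tabulate; allFin)
open import Data.List.Properties using (map-applyUpTo)
open import Data.List.Relation.Binary.Permutation.Propositional using (_↭_; ↭-sym; ↭-trans)
import Data.List.Relation.Binary.Permutation.Propositional as Perm
import Data.List.Relation.Binary.Permutation.Propositional.Properties as PermP
open import Data.Vec as Vec using (Vec; lookup)
open import Data.Product using (∃; _×_; _,_; proj₁; proj₂)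
open import Data.Sum using (_⊎_; inj₁; inj₂)
open import Data.Empty using (⊥-elim)
open import Relation.Nullary using (Dec; yes; no; does; ¬_; _×-dec_)
open import Relation.Unary using (Decidable)
open import Algebra.Properties.Semiring.Sum ℤP.+-*-semiring
  using (∑-distrib-+; ∑-comm; *-distribˡ-sum; *-distribʳ-sum; sum-cong-≗; sum-replicate-zero; sum-syntax)
open import Algebra.Properties.AbelianGroup ℤP.+-0-abelianGroup
  using () renaming (∙-cancelˡ to +-cancelˡ)
open import Relation.Binary.PropositionalEquality
open ≡-Reasoning
open +-*-Solver using (_:+_; _:*_; _:-_; :-_; _:=_; con) renaming (solve to solveℚ)

-- The recurrence behind the count, and the moments of the functional L

fac : ℕ → ℤ
fac n = + (n !)

fac-suc : ∀ n → fac (suc n) ≡ + suc n * fac n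
fac-suc n = ℤP.pos-* (suc n) (n !)

-- The permanent met in `perm-interleave`: k pairs of rows still to be filled, c + 1 unrestricted
-- rows set aside, and c free columns below the current threshold. The difference comes from
-- replacing a complement row by an all-one row minus an initial segment.
matchings : ℕ → ℕ → ℤ
matchings zero c = fac (suc c)
matchings (suc k) c =
  + suc (suc c) * matchings k (suc c) - + suc c * + suc c * matchings k c

-- moment k j is the value on yᵏ ∏_{i<j} (y - i²) of the linear functional
-- sending ∏_{i<j} (y - i²) to (-1)ʲ (j!)².
moment : ℕ → ℕ → ℤ
moment zero j = -1ℤ ^ j * (fac j * fac j)
moment (suc k) j = moment k (suc j) + + j * + j * moment k j

-- The rescaling by (-1)^(k+c+1) (c+1)! turns one recurrence into the other: passing from (c+1)! to
-- (c+2)! supplies the factor c + 2, and the alternating sign turns the sum into a difference.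
moment-matchings : ∀ k c →
  moment k (suc c) ≡ -1ℤ ^ k * (-1ℤ ^ suc c * (fac (suc c) * matchings k c))
moment-matchings zero c = sym (ℤP.*-identityˡ _)
moment-matchings (suc k) c =
  lemma (-1ℤ ^ k) (-1ℤ ^ c) (fac (suc c)) (matchings k (suc c)) (matchings k c)
    (+ suc c) (+ suc (suc c)) (fac-suc (suc c))
    (moment-matchings k (suc c)) (moment-matchings k c)
  where
  lemma : ∀ a b f p q x y {f′ m m′} → f′ ≡ y * f →
    m ≡ a * (-1ℤ * (-1ℤ * b) * (f′ * p)) → m′ ≡ a * (-1ℤ * b * (f * q)) →
    m + x * x * m′ ≡ -1ℤ * a * (-1ℤ * b * (f * (y * p - x * x * q)))
  lemma a b f p q x y refl refl refl = solve (a ∷ b ∷ f ∷ p ∷ q ∷ x ∷ y ∷ [])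

-- Products without the factor i = 0, and the variable x with y = x²

spread : (ℕ → ℤ) → ℕ → ℤ
spread u zero = u 0
spread u (suc zero) = 0ℤ
spread u (suc (suc k)) = spread (λ m → u (suc m)) k

-- shiftedMoment j m is the same functional on yᵐ⁻¹ ∏_{1≤i≤j} (y - i²), with y⁻¹ ↦ 0.
shiftedMoment : ℕ → ℕ → ℤ
shiftedMoment zero zero = 0ℤ
shiftedMoment zero (suc m) = moment m 0
shiftedMoment (suc j) m = shiftedMoment j (suc m) - + suc j * + suc j * shiftedMoment j m

spread-recurrence : ∀ (w u : ℕ → ℤ) a → (∀ m → w m ≡ u (suc m) - a * u m) →
  ∀ k → spread w k ≡ spread u (suc (suc k)) - a * spread u k
spread-recurrence w u a eq zero = eq 0
spread-recurrence w u a eq (suc zero) = lemma a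
  where
  lemma : ∀ a → 0ℤ ≡ 0ℤ - a * 0ℤ
  lemma = solve-∀
spread-recurrence w u a eq (suc (suc k)) = spread-recurrence _ _ a (λ m → eq (suc m)) k

-- The factor y = y - 0² completes the product: y ∏_{1≤i≤j} (y - i²) is ∏_{i<j+1} (y - i²).
shiftedMoment-moment : ∀ j m → shiftedMoment j (suc (suc m)) ≡ moment m (suc j)
shiftedMoment-moment zero m = ℤP.+-identityʳ _
shiftedMoment-moment (suc j) m =
  lemma (moment m (suc (suc j))) (+ suc j) (moment m (suc j))
    (shiftedMoment-moment j (suc m)) (shiftedMoment-moment j m)
  where
  lemma : ∀ a x b {e e′} → e ≡ a + x * x * b → e′ ≡ b → e - x * x * e′ ≡ a
  lemma a x b refl refl = solve (a ∷ x ∷ b ∷ [])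

-- This is the value on ∏_{1≤i≤j} (y - i²). Splitting off the factor y - (j+1)² leads to (-1)^(j+1)
-- ((j+1)!)² (1 + (j+1)).
shiftedMoment-1 : ∀ j → shiftedMoment j 1 ≡ -1ℤ ^ j * (fac j * fac (suc j))
shiftedMoment-1 zero = refl
shiftedMoment-1 (suc j) =
  lemma (-1ℤ ^ j) (fac j) (+ j) (fac-suc j) (fac-suc (suc j)) (shiftedMoment-moment j 0) (shiftedMoment-1 j)
  where
  lemma : ∀ s f x {f′ f″ e e′} → f′ ≡ (1ℤ + x) * f → f″ ≡ (1ℤ + (1ℤ + x)) * f′ →
    e ≡ -1ℤ * s * (f′ * f′) → e′ ≡ s * (f * f′) →
    e - (1ℤ + x) * (1ℤ + x) * e′ ≡ -1ℤ * s * (f′ * f″)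
  lemma s f x refl refl refl refl = solve (s ∷ f ∷ x ∷ [])

-- The functional x² q(x²) ↦ L(q): the initial 0 of `shiftedMoment 0` kills constants, and `spread`
-- kills odd powers.
evenMoment : ℕ → ℤ
evenMoment = spread (shiftedMoment 0)

-- Evaluating the functional on powers of 1 + 2x

-- A sequence u is read as the functional xᵏ ↦ u k on polynomials;
-- dilate n u is its composition with multiplication by (1 + 2x)ⁿ.
dilate : ℕ → (ℕ → ℤ) → ℕ → ℤ
dilate zero u k = u k
dilate (suc n) u k = dilate n u k + + 2 * dilate n u (suc k)

-- The factors 1 + 2x commute, so one of them may act on `u` first; this lets an identity for
-- `dilate 2 u` be used under further dilation.
dilate-suc : ∀ n u k → dilate (suc n) u k ≡ dilate n (dilate 1 u) k
dilate-suc zero u k = refl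
dilate-suc (suc n) u k = cong₂ (λ a b → a + + 2 * b) (dilate-suc n u k) (dilate-suc n u (suc k))

dilate-linear : ∀ n {u v w} a → (∀ k → u k ≡ v k + a * w k) →
  ∀ k → dilate n u k ≡ dilate n v k + a * dilate n w k
dilate-linear zero a eq k = eq k
dilate-linear (suc n) {u} {v} {w} a eq k =
  lemma a (dilate n v k) (dilate n w k) (dilate n v (suc k)) (dilate n w (suc k))
    (dilate-linear n a eq k) (dilate-linear n a eq (suc k))
  where
  lemma : ∀ a p q r s {x y} → x ≡ p + a * q → y ≡ r + a * s →
    x + + 2 * y ≡ p + + 2 * r + a * (q + + 2 * s)
  lemma a p q r s refl refl = solve (a ∷ p ∷ q ∷ r ∷ s ∷ [])

-- With z = 1 + 2x, oddMoment J is evenMoment composed with multiplication by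
-- ∏_{i<J} (z² - (2i+1)²) = 4ᴶ ∏_{i<J} (x - i)(x + i + 1), and for J ≥ 1 the latter
-- product is x (x + J) ∏_{1≤i<J} (x² - i²).
oddMoment : ℕ → ℕ → ℤ
oddMoment zero k = evenMoment k
oddMoment (suc J) k =
  (+ 4) ^ suc J * (spread (shiftedMoment J) (suc (suc k)) + + suc J * spread (shiftedMoment J) (suc k))

-- Multiplication by z² is split as (z² - (2J+1)²) + (2J+1)², the first summand being the next
-- factor of the product.
oddMoment-suc : ∀ J k →
  dilate 2 (oddMoment J) k ≡ oddMoment (suc J) k + (+ 2 * + J + 1ℤ) * (+ 2 * + J + 1ℤ) * oddMoment J k
oddMoment-suc zero k = lemma (evenMoment k) (evenMoment (suc k)) (evenMoment (suc (suc k)))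
  where
  lemma : ∀ a b c → a + + 2 * b + + 2 * (b + + 2 * c)
    ≡ + 4 * 1ℤ * (c + 1ℤ * b) + (+ 2 * 0ℤ + 1ℤ) * (+ 2 * 0ℤ + 1ℤ) * a
  lemma = solve-∀
oddMoment-suc (suc J) k =
  -- `spread-recurrence` brings in x² - (J+1)², and the rest is (x + J + 1)(z² - (2J+3)²) = 4 (x + J
  -- + 2)(x² - (J+1)²).
  lemma ((+ 4) ^ J) (+ suc J) (w 1) (w 2) (w 3) (w 4)
    (spread-recurrence (shiftedMoment (suc J)) (shiftedMoment J) (+ suc J * + suc J) (λ _ → refl) (suc k))
    (spread-recurrence (shiftedMoment (suc J)) (shiftedMoment J) (+ suc J * + suc J) (λ _ → refl) (suc (suc k)))
  where
  w : ℕ → ℤ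
  w i = spread (shiftedMoment J) (i ℕ.+ k)
  lemma : ∀ q x a b c d {e f} → e ≡ c - x * x * a → f ≡ d - x * x * b →
    + 4 * q * (b + x * a) + + 2 * (+ 4 * q * (c + x * b))
      + + 2 * (+ 4 * q * (c + x * b) + + 2 * (+ 4 * q * (d + x * c)))
    ≡ + 4 * (+ 4 * q) * (f + (1ℤ + x) * e)
      + (+ 2 * x + 1ℤ) * (+ 2 * x + 1ℤ) * (+ 4 * q * (b + x * a))
  lemma q x a b c d refl refl = solve (q ∷ x ∷ a ∷ b ∷ c ∷ d ∷ [])

double : ℕ → ℕ
double zero = zero
double (suc n) = suc (suc (double n))

dilate-oddMoment-suc : ∀ M J → dilate (double (suc M)) (oddMoment J) 0 ≡
  dilate (double M) (oddMoment (suc J)) 0 + (+ 2 * + J + 1ℤ) * (+ 2 * + J + 1ℤ)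
    * dilate (double M) (oddMoment J) 0
dilate-oddMoment-suc M J = begin
  dilate (suc (suc (double M))) (oddMoment J) 0  ≡⟨ dilate-suc (suc (double M)) (oddMoment J) 0 ⟩
  dilate (suc (double M)) (dilate 1 (oddMoment J)) 0  ≡⟨ dilate-suc (double M) (dilate 1 (oddMoment J)) 0 ⟩
  dilate (double M) (dilate 2 (oddMoment J)) 0  ≡⟨ dilate-linear (double M) {w = oddMoment J} c² (oddMoment-suc J) 0 ⟩
  dilate (double M) (oddMoment (suc J)) 0 + c² * dilate (double M) (oddMoment J) 0  ∎
  where
  c² = (+ 2 * + J + 1ℤ) * (+ 2 * + J + 1ℤ)

-- The value is independent of M: the step from M to M + 1 multiplies it by (2J+3)² - 4 (J+1)(J+2) =
-- 1, the second term coming from the product with one more factor.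
dilate-oddMoment : ∀ M J →
  dilate (double M) (oddMoment (suc J)) 0 ≡ (+ 4) ^ suc J * (-1ℤ ^ J * (fac J * fac (suc J)))
-- Of x (x + J + 1) ∏ (x² - i²) only the part with x² has even degree; its value is
-- `shiftedMoment J 1`.
dilate-oddMoment zero J = lemma ((+ 4) ^ suc J) (+ suc J) (shiftedMoment-1 J)
  where
  lemma : ∀ q x {a b} → a ≡ b → q * (a + x * 0ℤ) ≡ q * b
  lemma q x {a} refl = solve (q ∷ x ∷ a ∷ [])
dilate-oddMoment (suc M) J =
  lemma ((+ 4) ^ J) (-1ℤ ^ J) (fac J) (+ J) (fac-suc J) (fac-suc (suc J))
    (dilate-oddMoment-suc M (suc J)) (dilate-oddMoment M (suc J)) (dilate-oddMoment M J)
  where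
  lemma : ∀ q s f x {f′ f″ d e e′} → f′ ≡ (1ℤ + x) * f → f″ ≡ (1ℤ + (1ℤ + x)) * f′ →
    d ≡ e + (+ 2 * (1ℤ + x) + 1ℤ) * (+ 2 * (1ℤ + x) + 1ℤ) * e′ →
    e ≡ + 4 * (+ 4 * q) * (-1ℤ * s * (f′ * f″)) → e′ ≡ + 4 * q * (s * (f * f′)) →
    d ≡ + 4 * q * (s * (f * f′))
  lemma q s f x refl refl refl refl refl = solve (q ∷ s ∷ f ∷ x ∷ [])

-- Since z² = (z² - 1) + 1, raising M by 1 adds the value on z²ᴹ (z² - 1), which is 4 for every M by
-- `dilate-oddMoment`.
dilate-evenMoment : ∀ M → dilate (double M) evenMoment 0 ≡ + 4 * + M
dilate-evenMoment zero = refl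
dilate-evenMoment (suc M) =
  lemma (+ M) (dilate-oddMoment-suc M 0) (dilate-oddMoment M 0) (dilate-evenMoment M)
  where
  lemma : ∀ x {d e e′} → d ≡ e + 1ℤ * e′ → e ≡ + 4 → e′ ≡ + 4 * x → d ≡ + 4 * (1ℤ + x)
  lemma x refl refl refl = solve (x ∷ [])

-- Integers and reciprocals in the rationals

ι : ℤ → ℚ
ι z = z / 1

ι-+ : ∀ a b → ι (a + b) ≡ ι a ℚ.+ ι b
ι-+ a b = ℚP.toℚᵘ-injective (ℚᵘP.≃-trans (ℚP.toℚᵘ-fromℚᵘ (mkℚᵘ (a + b) 0))
  (ℚᵘP.≃-trans (*≡* (lemma a b))
  (ℚᵘP.≃-sym (ℚᵘP.≃-trans (ℚP.toℚᵘ-homo-+ (ι a) (ι b))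
    (ℚᵘP.+-cong (ℚP.toℚᵘ-fromℚᵘ (mkℚᵘ a 0)) (ℚP.toℚᵘ-fromℚᵘ (mkℚᵘ b 0)))))))
  where
  lemma : ∀ a b → (a + b) * + 1 ≡ (a * + 1 + b * + 1) * + 1
  lemma = solve-∀

/-* : ∀ a b m n → (a / suc m) ℚ.* (b / suc n) ≡ (a * b) / (suc m ℕ.* suc n)
/-* a b m n = ℚP.toℚᵘ-injective (ℚᵘP.≃-trans (ℚP.toℚᵘ-homo-* (a / suc m) (b / suc n))
  (ℚᵘP.≃-trans (ℚᵘP.*-cong (ℚP.toℚᵘ-fromℚᵘ (mkℚᵘ a m)) (ℚP.toℚᵘ-fromℚᵘ (mkℚᵘ b n)))
  (ℚᵘP.≃-sym (ℚP.toℚᵘ-fromℚᵘ (mkℚᵘ (a * b) (n ℕ.+ m ℕ.* suc n))))))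

ι-* : ∀ a b → ι (a * b) ≡ ι a ℚ.* ι b
ι-* a b = sym (/-* a b 0 0)

inv-* : ∀ m n → inv (m ℕ.* n) ≡ inv m ℚ.* inv n
inv-* zero n = sym (ℚP.*-zeroˡ (inv n))
inv-* (suc m) zero rewrite ℕP.*-zeroʳ m = sym (ℚP.*-zeroʳ (inv (suc m)))
inv-* (suc m) (suc n) = sym (/-* (+ 1) (+ 1) m n)

ι-inv : ∀ n → ι (+ suc n) ℚ.* inv (suc n) ≡ 1ℚ
ι-inv n = begin
  ι (+ suc n) ℚ.* inv (suc n)      ≡⟨ /-* (+ suc n) (+ 1) 0 n ⟩
  (+ suc n * + 1) / (1 ℕ.* suc n)  ≡⟨ ℚP.fromℚᵘ-cong {mkℚᵘ (+ suc n * + 1) (n ℕ.+ 0)} {mkℚᵘ (+ 1) 0} (*≡* lemma) ⟩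
  1ℚ                               ∎
  where
  lemma : + suc n * + 1 * + 1 ≡ + 1 * + suc (n ℕ.+ 0)
  lemma = cong +_ (trans (ℕP.*-identityʳ (suc n ℕ.* 1))
    (trans (ℕP.*-comm (suc n) 1) (sym (ℕP.*-identityˡ _))))

-- Cauchy products and quotients of power series

conv : (ℕ → ℕ → ℚ) → ℕ → ℚ
conv φ zero = φ 0 0
conv φ (suc n) = φ 0 (suc n) ℚ.+ conv (λ i k → φ (suc i) k) n

conv-cong : ∀ {φ ψ} n → (∀ i k → i ℕ.+ k ≡ n → φ i k ≡ ψ i k) → conv φ n ≡ conv ψ n
conv-cong zero eq = eq 0 0 refl
conv-cong (suc n) eq =
  cong₂ ℚ._+_ (eq 0 (suc n) refl) (conv-cong n λ i k p → eq (suc i) k (cong suc p))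

conv-+ : ∀ φ ψ n → conv (λ i k → φ i k ℚ.+ ψ i k) n ≡ conv φ n ℚ.+ conv ψ n
conv-+ φ ψ zero = refl
conv-+ φ ψ (suc n) = trans
  (cong (φ 0 (suc n) ℚ.+ ψ 0 (suc n) ℚ.+_) (conv-+ (λ i k → φ (suc i) k) (λ i k → ψ (suc i) k) n))
  (lemma (φ 0 (suc n)) (ψ 0 (suc n)) _ _)
  where
  lemma : ∀ a b c d → a ℚ.+ b ℚ.+ (c ℚ.+ d) ≡ a ℚ.+ c ℚ.+ (b ℚ.+ d)
  lemma = solveℚ 4 (λ a b c d → a :+ b :+ (c :+ d) := a :+ c :+ (b :+ d)) refl

conv-* : ∀ x φ n → conv (λ i k → x ℚ.* φ i k) n ≡ x ℚ.* conv φ n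
conv-* x φ zero = refl
conv-* x φ (suc n) = trans
  (cong (x ℚ.* φ 0 (suc n) ℚ.+_) (conv-* x (λ i k → φ (suc i) k) n))
  (sym (ℚP.*-distribˡ-+ x (φ 0 (suc n)) (conv (λ i k → φ (suc i) k) n)))

conv-last : ∀ φ n → conv φ (suc n) ≡ conv (λ i k → φ i (suc k)) n ℚ.+ φ (suc n) 0
conv-last φ zero = refl
conv-last φ (suc n) = trans
  (cong (φ 0 (suc (suc n)) ℚ.+_) (conv-last (λ i k → φ (suc i) k) n))
  (sym (ℚP.+-assoc (φ 0 (suc (suc n))) (conv (λ i k → φ (suc i) (suc k)) n) (φ (suc (suc n)) 0)))

foldr-zipWith-conv : ∀ (f τ : ℕ → ℚ) n →
  foldr ℚ._+_ 0ℚ (zipWith ℚ._*_ (applyUpTo f (suc n)) (applyDownFrom τ (suc n)))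
  ≡ conv (λ i k → f i ℚ.* τ k) n
foldr-zipWith-conv f τ zero = ℚP.+-identityʳ (f 0 ℚ.* τ 0)
foldr-zipWith-conv f τ (suc n) =
  cong (f 0 ℚ.* τ (suc n) ℚ.+_) (foldr-zipWith-conv (λ i → f (suc i)) τ n)

-- Because C 0 = 1, the equation C τ = S determines each coefficient of τ from the earlier ones, by
-- exactly the recursion of `quotRev`. A guessed quotient thus only has to be multiplied by C.
quotRev-unique : ∀ {S C τ} → C 0 ≡ 1ℚ → (∀ n → conv (λ i k → C i ℚ.* τ k) n ≡ S n) →
  ∀ n → quotRev S C n ≡ applyDownFrom τ (suc n)
quotRev-unique {S} {C} {τ} C₀ eq zero = cong (_∷ []) (begin
  S 0          ≡⟨ sym (eq 0) ⟩
  C 0 ℚ.* τ 0  ≡⟨ cong (ℚ._* τ 0) C₀ ⟩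
  1ℚ ℚ.* τ 0   ≡⟨ ℚP.*-identityˡ (τ 0) ⟩
  τ 0          ∎)
quotRev-unique {S} {C} {τ} C₀ eq (suc n)
  rewrite quotRev-unique {S} {C} {τ} C₀ eq n =
  cong (_∷ τs) (begin
    S (suc n) ℚ.- foldr ℚ._+_ 0ℚ (zipWith ℚ._*_ (map C′ (upTo (suc n))) τs)
      ≡⟨ cong (λ Cs → S (suc n) ℚ.- foldr ℚ._+_ 0ℚ (zipWith ℚ._*_ Cs τs))
           (map-applyUpTo (λ j → j) C′ (suc n)) ⟩
    S (suc n) ℚ.- foldr ℚ._+_ 0ℚ (zipWith ℚ._*_ (applyUpTo C′ (suc n)) τs)
      ≡⟨ cong₂ ℚ._-_ (sym (eq (suc n))) (foldr-zipWith-conv C′ τ n) ⟩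
    (C 0 ℚ.* τ (suc n) ℚ.+ rest) ℚ.- rest
      ≡⟨ cong (λ x → (x ℚ.* τ (suc n) ℚ.+ rest) ℚ.- rest) C₀ ⟩
    (1ℚ ℚ.* τ (suc n) ℚ.+ rest) ℚ.- rest
      ≡⟨ lemma (τ (suc n)) rest ⟩
    τ (suc n) ∎)
  where
  C′ : ℕ → ℚ
  C′ j = C (suc j)
  τs = applyDownFrom τ (suc n)
  rest = conv (λ i k → C′ i ℚ.* τ k) n
  lemma : ∀ t r → (1ℚ ℚ.* t ℚ.+ r) ℚ.- r ≡ t
  lemma = solveℚ 2 (λ t r → (con 1ℚ :* t :+ r) :- r := t) refl

-- Binomial expansion of (1 + 2x)ⁿ through exponential series

inv! : ℕ → ℚ
inv! k = inv (k !)

suc-inv! : ∀ n → ι (+ suc n) ℚ.* inv! (suc n) ≡ inv! n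
suc-inv! n = begin
  ι (+ suc n) ℚ.* inv (suc n ℕ.* n !)       ≡⟨ cong (ι (+ suc n) ℚ.*_) (inv-* (suc n) (n !)) ⟩
  ι (+ suc n) ℚ.* (inv (suc n) ℚ.* inv! n)  ≡⟨ sym (ℚP.*-assoc (ι (+ suc n)) (inv (suc n)) (inv! n)) ⟩
  ι (+ suc n) ℚ.* inv (suc n) ℚ.* inv! n    ≡⟨ cong (ℚ._* inv! n) (ι-inv n) ⟩
  1ℚ ℚ.* inv! n                             ≡⟨ ℚP.*-identityˡ (inv! n) ⟩
  inv! n                                    ∎

inv!-suc : ∀ n → inv! (suc n) ≡ inv (suc n) ℚ.* inv! n
inv!-suc n = inv-* (suc n) (n !)

-- Terms of the product exp(t) exp(2xt), with xʲ⁺ᵏ replaced by `u (j + k)`; over i + k = n they sum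
-- to the value of `u` on xʲ (1 + 2x)ⁿ / n!.
egf : (ℕ → ℤ) → ℕ → ℕ → ℕ → ℚ
egf u j i k = inv! i ℚ.* (ι ((+ 2) ^ k) ℚ.* inv! k) ℚ.* ι (u (j ℕ.+ k))

egf-sucˡ : ∀ u j i k → ι (+ suc i) ℚ.* egf u j (suc i) k ≡ egf u j i k
egf-sucˡ u j i k =
  trans (lemma (ι (+ suc i)) (inv! (suc i)) (ι ((+ 2) ^ k) ℚ.* inv! k) (ι (u (j ℕ.+ k))))
    (cong (λ x → x ℚ.* (ι ((+ 2) ^ k) ℚ.* inv! k) ℚ.* ι (u (j ℕ.+ k))) (suc-inv! i))
  where
  lemma : ∀ n x y z → n ℚ.* (x ℚ.* y ℚ.* z) ≡ n ℚ.* x ℚ.* y ℚ.* z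
  lemma = solveℚ 4 (λ n x y z → n :* (x :* y :* z) := n :* x :* y :* z) refl

egf-sucʳ : ∀ u j i k → ι (+ suc k) ℚ.* egf u j i (suc k) ≡ ι (+ 2) ℚ.* egf u (suc j) i k
egf-sucʳ u j i k = begin
  ι (+ suc k) ℚ.* (inv! i ℚ.* (ι (+ 2 * (+ 2) ^ k) ℚ.* inv! (suc k)) ℚ.* ι (u (j ℕ.+ suc k)))
    ≡⟨ cong₂ (λ t v → ι (+ suc k) ℚ.* (inv! i ℚ.* (t ℚ.* inv! (suc k)) ℚ.* ι (u v)))
         (ι-* (+ 2) ((+ 2) ^ k)) (ℕP.+-suc j k) ⟩
  ι (+ suc k) ℚ.* (inv! i ℚ.* (ι (+ 2) ℚ.* ι ((+ 2) ^ k) ℚ.* inv! (suc k)) ℚ.* ι (u (suc j ℕ.+ k)))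
    ≡⟨ lemma (ι (+ suc k)) (inv! i) (ι (+ 2)) (ι ((+ 2) ^ k)) (inv! (suc k)) (ι (u (suc j ℕ.+ k))) ⟩
  ι (+ 2) ℚ.* (inv! i ℚ.* (ι ((+ 2) ^ k) ℚ.* (ι (+ suc k) ℚ.* inv! (suc k))) ℚ.* ι (u (suc j ℕ.+ k)))
    ≡⟨ cong (λ t → ι (+ 2) ℚ.* (inv! i ℚ.* (ι ((+ 2) ^ k) ℚ.* t) ℚ.* ι (u (suc j ℕ.+ k)))) (suc-inv! k) ⟩
  ι (+ 2) ℚ.* egf u (suc j) i k ∎
  where
  lemma : ∀ n x t p y z →
    n ℚ.* (x ℚ.* (t ℚ.* p ℚ.* y) ℚ.* z) ≡ t ℚ.* (x ℚ.* (p ℚ.* (n ℚ.* y)) ℚ.* z)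
  lemma = solveℚ 6 (λ n x t p y z →
    n :* (x :* (t :* p :* y) :* z) := t :* (x :* (p :* (n :* y)) :* z)) refl

-- Write n + 1 = i + k in each term and cancel i against i! and k against k!: the product rule for
-- exp(t) exp(2xt).
conv-egf-suc : ∀ u j n → ι (+ suc n) ℚ.* conv (egf u j) (suc n) ≡
  conv (egf u j) n ℚ.+ ι (+ 2) ℚ.* conv (egf u (suc j)) n
conv-egf-suc u j n = begin
  ι (+ suc n) ℚ.* conv φ (suc n)
    ≡⟨ sym (conv-* (ι (+ suc n)) φ (suc n)) ⟩
  conv (λ i k → ι (+ suc n) ℚ.* φ i k) (suc n)
    ≡⟨ conv-cong (suc n) split ⟩
  conv (λ i k → ι (+ i) ℚ.* φ i k ℚ.+ ι (+ k) ℚ.* φ i k) (suc n)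
    ≡⟨ conv-+ (λ i k → ι (+ i) ℚ.* φ i k) (λ i k → ι (+ k) ℚ.* φ i k) (suc n) ⟩
  conv (λ i k → ι (+ i) ℚ.* φ i k) (suc n) ℚ.+ conv (λ i k → ι (+ k) ℚ.* φ i k) (suc n)
    ≡⟨ cong₂ ℚ._+_ left right ⟩
  conv φ n ℚ.+ ι (+ 2) ℚ.* conv (egf u (suc j)) n ∎
  where
  φ = egf u j
  split : ∀ i k → i ℕ.+ k ≡ suc n → ι (+ suc n) ℚ.* φ i k ≡ ι (+ i) ℚ.* φ i k ℚ.+ ι (+ k) ℚ.* φ i k
  split i k i+k≡n = trans (cong (λ m → ι (+ m) ℚ.* φ i k) (sym i+k≡n))
    (trans (cong (ℚ._* φ i k) (ι-+ (+ i) (+ k))) (ℚP.*-distribʳ-+ (φ i k) (ι (+ i)) (ι (+ k))))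
  left : conv (λ i k → ι (+ i) ℚ.* φ i k) (suc n) ≡ conv φ n
  left = trans (cong₂ ℚ._+_ (ℚP.*-zeroˡ (φ 0 (suc n))) (conv-cong n (λ i k _ → egf-sucˡ u j i k)))
    (ℚP.+-identityˡ (conv φ n))
  right : conv (λ i k → ι (+ k) ℚ.* φ i k) (suc n) ≡ ι (+ 2) ℚ.* conv (egf u (suc j)) n
  right = begin
    conv (λ i k → ι (+ k) ℚ.* φ i k) (suc n)
      ≡⟨ conv-last (λ i k → ι (+ k) ℚ.* φ i k) n ⟩
    conv (λ i k → ι (+ suc k) ℚ.* φ i (suc k)) n ℚ.+ 0ℚ ℚ.* φ (suc n) 0
      ≡⟨ cong₂ ℚ._+_ (conv-cong n (λ i k _ → egf-sucʳ u j i k)) (ℚP.*-zeroˡ (φ (suc n) 0)) ⟩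
    conv (λ i k → ι (+ 2) ℚ.* egf u (suc j) i k) n ℚ.+ 0ℚ
      ≡⟨ ℚP.+-identityʳ _ ⟩
    conv (λ i k → ι (+ 2) ℚ.* egf u (suc j) i k) n
      ≡⟨ conv-* (ι (+ 2)) (egf u (suc j)) n ⟩
    ι (+ 2) ℚ.* conv (egf u (suc j)) n ∎

conv-egf : ∀ u n j → conv (egf u j) n ≡ inv! n ℚ.* ι (dilate n u j)
conv-egf u zero j rewrite ℕP.+-identityʳ j = refl
conv-egf u (suc n) j = begin
  conv (egf u j) (suc n)
    ≡⟨ sym (ℚP.*-identityˡ _) ⟩
  1ℚ ℚ.* conv (egf u j) (suc n)
    ≡⟨ cong (ℚ._* conv (egf u j) (suc n)) (sym (trans (ℚP.*-comm (inv (suc n)) (ι (+ suc n))) (ι-inv n))) ⟩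
  inv (suc n) ℚ.* ι (+ suc n) ℚ.* conv (egf u j) (suc n)
    ≡⟨ ℚP.*-assoc (inv (suc n)) (ι (+ suc n)) (conv (egf u j) (suc n)) ⟩
  inv (suc n) ℚ.* (ι (+ suc n) ℚ.* conv (egf u j) (suc n))
    ≡⟨ cong (inv (suc n) ℚ.*_) (conv-egf-suc u j n) ⟩
  inv (suc n) ℚ.* (conv (egf u j) n ℚ.+ ι (+ 2) ℚ.* conv (egf u (suc j)) n)
    ≡⟨ cong₂ (λ x y → inv (suc n) ℚ.* (x ℚ.+ ι (+ 2) ℚ.* y)) (conv-egf u n j) (conv-egf u n (suc j)) ⟩
  inv (suc n) ℚ.* (inv! n ℚ.* ι d ℚ.+ ι (+ 2) ℚ.* (inv! n ℚ.* ι d′))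
    ≡⟨ lemma (inv (suc n)) (inv! n) (ι d) (ι (+ 2)) (ι d′) ⟩
  inv (suc n) ℚ.* inv! n ℚ.* (ι d ℚ.+ ι (+ 2) ℚ.* ι d′)
    ≡⟨ cong₂ ℚ._*_ (sym (inv!-suc n)) (sym (trans (ι-+ d (+ 2 * d′)) (cong (ι d ℚ.+_) (ι-* (+ 2) d′)))) ⟩
  inv! (suc n) ℚ.* ι (d + + 2 * d′) ∎
  where
  d = dilate n u j
  d′ = dilate n u (suc j)
  lemma : ∀ i x d t e → i ℚ.* (x ℚ.* d ℚ.+ t ℚ.* (x ℚ.* e)) ≡ i ℚ.* x ℚ.* (d ℚ.+ t ℚ.* e)
  lemma = solveℚ 5 (λ i x d t e → i :* (x :* d :+ t :* (x :* e)) := i :* x :* (d :+ t :* e)) refl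

-- Gives all terms of a convolution the same power of 1/2; the compensating 2ᵏ is the one that `egf`
-- carries.
pow-split : ∀ i k → inv (2 ℕ.^ i) ≡ inv (2 ℕ.^ (i ℕ.+ k)) ℚ.* ι ((+ 2) ^ k)
pow-split i zero rewrite ℕP.+-identityʳ i = sym (ℚP.*-identityʳ _)
pow-split i (suc k) = begin
  inv (2 ℕ.^ i)
    ≡⟨ pow-split i k ⟩
  inv (2 ℕ.^ (i ℕ.+ k)) ℚ.* ι ((+ 2) ^ k)
    ≡⟨ lemma (inv (2 ℕ.^ (i ℕ.+ k))) (ι ((+ 2) ^ k)) ⟩
  inv 2 ℚ.* inv (2 ℕ.^ (i ℕ.+ k)) ℚ.* (ι (+ 2) ℚ.* ι ((+ 2) ^ k))
    ≡⟨ cong₂ ℚ._*_ (trans (sym (inv-* 2 (2 ℕ.^ (i ℕ.+ k)))) (cong (λ e → inv (2 ℕ.^ e)) (sym (ℕP.+-suc i k))))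
         (sym (ι-* (+ 2) ((+ 2) ^ k))) ⟩
  inv (2 ℕ.^ (i ℕ.+ suc k)) ℚ.* ι ((+ 2) ^ suc k) ∎
  where
  lemma : ∀ p q → p ℚ.* q ≡ inv 2 ℚ.* p ℚ.* (ι (+ 2) ℚ.* q)
  lemma = solveℚ 2 (λ p q → p :* q := con (inv 2) :* p :* (con (ι (+ 2)) :* q)) refl

-- Sign patterns of the sine and cosine series

cos₄ sin₄ : ℕ → ℤ
cos₄ 0 = 1ℤ
cos₄ 2 = -1ℤ
cos₄ _ = 0ℤ
sin₄ 1 = 1ℤ
sin₄ 3 = -1ℤ
sin₄ _ = 0ℤ

-- These are cos(kπ/2) and sin(kπ/2), so the signs of the two series obey the addition formulas.
cosℤ sinℤ : ℕ → ℤ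
cosℤ k = cos₄ (k ℕ.% 4)
sinℤ k = sin₄ (k ℕ.% 4)

neg-ι : ∀ x → ℚ.- x ≡ ι -1ℤ ℚ.* x
neg-ι = solveℚ 1 (λ x → :- x := con (ι -1ℤ) :* x) refl

cosHalf-cosℤ : ∀ k → cosHalf k ≡ ι (cosℤ k) ℚ.* inv (2 ℕ.^ k ℕ.* k !)
cosHalf-cosℤ k with k ℕ.% 4
... | 0 = sym (ℚP.*-identityˡ _)
... | 1 = sym (ℚP.*-zeroˡ (inv (2 ℕ.^ k ℕ.* k !)))
... | 2 = neg-ι _
... | suc (suc (suc _)) = sym (ℚP.*-zeroˡ (inv (2 ℕ.^ k ℕ.* k !)))

sinHalf-sinℤ : ∀ k → sinHalf k ≡ ι (sinℤ k) ℚ.* inv (2 ℕ.^ k ℕ.* k !)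
sinHalf-sinℤ k with k ℕ.% 4
... | 0 = sym (ℚP.*-zeroˡ (inv (2 ℕ.^ k ℕ.* k !)))
... | 1 = sym (ℚP.*-identityˡ _)
... | 2 = sym (ℚP.*-zeroˡ (inv (2 ℕ.^ k ℕ.* k !)))
... | 3 = neg-ι _
... | suc (suc (suc (suc _))) = sym (ℚP.*-zeroˡ (inv (2 ℕ.^ k ℕ.* k !)))

cosℤ-suc : ∀ k → cosℤ (suc k) ≡ - sinℤ k
cosℤ-suc 0 = refl
cosℤ-suc 1 = refl
cosℤ-suc 2 = refl
cosℤ-suc 3 = refl
cosℤ-suc (suc (suc (suc (suc k)))) = cosℤ-suc k

sinℤ-suc : ∀ k → sinℤ (suc k) ≡ cosℤ k
sinℤ-suc 0 = refl
sinℤ-suc 1 = refl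
sinℤ-suc 2 = refl
sinℤ-suc 3 = refl
sinℤ-suc (suc (suc (suc (suc k)))) = sinℤ-suc k

cosℤ-+ : ∀ i k → cosℤ (i ℕ.+ k) ≡ cosℤ i * cosℤ k - sinℤ i * sinℤ k
sinℤ-+ : ∀ i k → sinℤ (i ℕ.+ k) ≡ sinℤ i * cosℤ k + cosℤ i * sinℤ k
cosℤ-+ zero k = lemma (cosℤ k) (sinℤ k)
  where
  lemma : ∀ x y → x ≡ 1ℤ * x - 0ℤ * y
  lemma = solve-∀
cosℤ-+ (suc i) k =
  lemma (cosℤ i) (sinℤ i) (cosℤ k) (sinℤ k) (cosℤ-suc (i ℕ.+ k)) (sinℤ-+ i k) (cosℤ-suc i) (sinℤ-suc i)
  where
  lemma : ∀ ci si ck sk {x y z w} → x ≡ - y → y ≡ si * ck + ci * sk → z ≡ - si → w ≡ ci →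
    x ≡ z * ck - w * sk
  lemma ci si ck sk refl refl refl refl = solve (ci ∷ si ∷ ck ∷ sk ∷ [])
sinℤ-+ zero k = lemma (cosℤ k) (sinℤ k)
  where
  lemma : ∀ x y → y ≡ 0ℤ * x + 1ℤ * y
  lemma = solve-∀
sinℤ-+ (suc i) k =
  lemma (cosℤ i) (sinℤ i) (cosℤ k) (sinℤ k) (sinℤ-suc (i ℕ.+ k)) (cosℤ-+ i k) (cosℤ-suc i) (sinℤ-suc i)
  where
  lemma : ∀ ci si ck sk {x y z w} → x ≡ y → y ≡ ci * ck - si * sk → z ≡ - si → w ≡ ci →
    x ≡ w * ck + z * sk
  lemma ci si ck sk refl refl refl refl = solve (ci ∷ si ∷ ck ∷ sk ∷ [])

-- The coefficients of x tan(x/2)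

sinℤ-spread : ∀ u k → sinℤ k * spread u k ≡ 0ℤ
sinℤ-spread u zero = ℤP.*-zeroˡ (u 0)
sinℤ-spread u (suc zero) = refl
sinℤ-spread u (suc (suc k)) =
  lemma (sinℤ k) (trans (sinℤ-suc (suc k)) (cosℤ-suc k)) (sinℤ-spread (λ m → u (suc m)) k)
  where
  lemma : ∀ x {y z} → y ≡ - x → x * z ≡ 0ℤ → y * z ≡ 0ℤ
  lemma x {z = z} refl eq = trans (sym (ℤP.neg-distribˡ-* x z)) (cong -_ eq)

-- The candidate for k! times the coefficient of xᵏ in x tan(x/2). The sign is (-1)ᵐ⁺¹ at k = 2m,
-- and odd k give 0.
xTanℤ : ℕ → ℤ
xTanℤ k = - (cosℤ k * evenMoment k)

-- The sine terms of the addition formula for cos ((i + k)π/2) vanish because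
-- spread u is supported on even indices.
cosℤ-xTanℤ : ∀ i k → cosℤ i * xTanℤ k ≡ - cosℤ (i ℕ.+ k) * evenMoment k
cosℤ-xTanℤ i k =
  lemma (cosℤ i) (sinℤ i) (cosℤ k) (sinℤ k) (evenMoment k) (cosℤ-+ i k) (sinℤ-spread (shiftedMoment 0) k)
  where
  lemma : ∀ ci si ck sk e {x} → x ≡ ci * ck - si * sk → sk * e ≡ 0ℤ →
    ci * - (ck * e) ≡ - x * e
  lemma ci si ck sk e refl eq = begin
    ci * - (ck * e)                  ≡⟨ solve (ci ∷ si ∷ ck ∷ e ∷ []) ⟩
    - (ci * ck * e) + si * 0ℤ        ≡⟨ cong (λ z → - (ci * ck * e) + si * z) (sym eq) ⟩
    - (ci * ck * e) + si * (sk * e)  ≡⟨ solve (ci ∷ si ∷ ck ∷ sk ∷ e ∷ []) ⟩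
    - (ci * ck - si * sk) * e        ∎

cosℤ-double : ∀ m → cosℤ (double m) ≡ -1ℤ ^ m
cosℤ-double zero = refl
cosℤ-double (suc m) = begin
  cosℤ (suc (suc (double m)))  ≡⟨ trans (cosℤ-suc (suc (double m))) (cong -_ (sinℤ-suc (double m))) ⟩
  - cosℤ (double m)            ≡⟨ cong -_ (cosℤ-double m) ⟩
  - (-1ℤ ^ m)                  ≡⟨ sym (ℤP.-1*i≡-i (-1ℤ ^ m)) ⟩
  -1ℤ * -1ℤ ^ m                ∎

sinℤ-double : ∀ m → sinℤ (double m) ≡ 0ℤ
sinℤ-double zero = refl
sinℤ-double (suc m) = trans (trans (sinℤ-suc (suc (double m))) (cosℤ-suc (double m))) (cong -_ (sinℤ-double m))

+-double : ∀ m → + double m ≡ + 2 * + m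
+-double zero = refl
+-double (suc m) = trans (cong (λ x → + 2 + x) (+-double m)) (lemma (+ m))
  where
  lemma : ∀ x → + 2 + + 2 * x ≡ + 2 * (1ℤ + x)
  lemma = solve-∀

even⊎odd : ∀ n → (∃ λ m → n ≡ double m) ⊎ (∃ λ m → n ≡ suc (double m))
even⊎odd zero = inj₁ (0 , refl)
even⊎odd (suc n) with even⊎odd n
... | inj₁ (m , refl) = inj₂ (m , refl)
... | inj₂ (m , refl) = inj₁ (suc m , refl)

-- For odd n the cosine vanishes, so the functional is evaluated only on even powers of 1 + 2x.
cosℤ-dilate : ∀ n → cosℤ n * dilate n evenMoment 0 ≡ cosℤ n * (+ 2 * + n)
cosℤ-dilate n with even⊎odd n
... | inj₁ (m , refl) = cong (cosℤ (double m) *_) (lemma (+ m) (dilate-evenMoment m) (+-double m))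
  where
  lemma : ∀ x {d y} → d ≡ + 4 * x → y ≡ + 2 * x → d ≡ + 2 * y
  lemma x refl refl = solve (x ∷ [])
... | inj₂ (m , refl) =
  lemma (trans (cosℤ-suc (double m)) (cong -_ (sinℤ-double m))) (dilate (suc (double m)) evenMoment 0) _
  where
  lemma : ∀ {x} → x ≡ 0ℤ → ∀ d e → x * d ≡ x * e
  lemma refl d e = trans (ℤP.*-zeroˡ d) (sym (ℤP.*-zeroˡ e))

tanCoeff : ℕ → ℚ
tanCoeff k = ι (xTanℤ (suc k)) ℚ.* inv! (suc k)

-- After `cosℤ-xTanℤ` the factor in front of `egf` depends only on i + k + 1, so it can leave the
-- convolution.
cosHalf-tanCoeff : ∀ i k → cosHalf i ℚ.* tanCoeff k ≡
  inv (2 ℕ.^ (i ℕ.+ suc k)) ℚ.* ι (- cosℤ (i ℕ.+ suc k)) ℚ.* egf evenMoment 0 i (suc k)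
cosHalf-tanCoeff i k = begin
  cosHalf i ℚ.* tanCoeff k
    ≡⟨ cong (ℚ._* tanCoeff k) (trans (cosHalf-cosℤ i) (cong (ι (cosℤ i) ℚ.*_) (trans (inv-* (2 ℕ.^ i) (i !))
         (cong (ℚ._* inv! i) (pow-split i (suc k)))))) ⟩
  ι (cosℤ i) ℚ.* (p ℚ.* ι t ℚ.* inv! i) ℚ.* (ι (xTanℤ (suc k)) ℚ.* inv! (suc k))
    ≡⟨ lemma (ι (cosℤ i)) p (ι t) (inv! i) (ι (xTanℤ (suc k))) (inv! (suc k)) ⟩
  p ℚ.* (ι (cosℤ i) ℚ.* ι (xTanℤ (suc k))) ℚ.* (inv! i ℚ.* (ι t ℚ.* inv! (suc k)))
    ≡⟨ cong (λ x → p ℚ.* x ℚ.* (inv! i ℚ.* (ι t ℚ.* inv! (suc k))))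
         (trans (sym (ι-* (cosℤ i) (xTanℤ (suc k)))) (trans (cong ι (cosℤ-xTanℤ i (suc k))) (ι-* (- cosℤ n) e))) ⟩
  p ℚ.* (ι (- cosℤ n) ℚ.* ι e) ℚ.* (inv! i ℚ.* (ι t ℚ.* inv! (suc k)))
    ≡⟨ lemma′ p (ι (- cosℤ n)) (ι e) (inv! i ℚ.* (ι t ℚ.* inv! (suc k))) ⟩
  p ℚ.* ι (- cosℤ n) ℚ.* (inv! i ℚ.* (ι t ℚ.* inv! (suc k)) ℚ.* ι e) ∎
  where
  n = i ℕ.+ suc k
  p = inv (2 ℕ.^ n)
  t = (+ 2) ^ suc k
  e = evenMoment (suc k)
  lemma : ∀ x p t y z w → x ℚ.* (p ℚ.* t ℚ.* y) ℚ.* (z ℚ.* w) ≡ p ℚ.* (x ℚ.* z) ℚ.* (y ℚ.* (t ℚ.* w))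
  lemma = solveℚ 6 (λ x p t y z w →
    x :* (p :* t :* y) :* (z :* w) := p :* (x :* z) :* (y :* (t :* w))) refl
  lemma′ : ∀ p x e y → p ℚ.* (x ℚ.* e) ℚ.* y ≡ p ℚ.* x ℚ.* (y ℚ.* e)
  lemma′ = solveℚ 4 (λ p x e y → p :* (x :* e) :* y := p :* x :* (y :* e)) refl

-- The convolution becomes the functional on (1 + 2x)ⁿ⁺¹, worth 2 (n + 1) whenever its cosine factor
-- is nonzero; this reduces the denominator 2ⁿ⁺¹ (n + 1)! to 2ⁿ n!.
conv-cosHalf-tanCoeff : ∀ n → conv (λ i k → cosHalf i ℚ.* tanCoeff k) n ≡ sinHalf n
conv-cosHalf-tanCoeff n = begin
  conv (λ i k → cosHalf i ℚ.* tanCoeff k) n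
    ≡⟨ conv-cong n (λ i k eq → trans (cosHalf-tanCoeff i k)
         (cong (λ m → inv (2 ℕ.^ m) ℚ.* ι (- cosℤ m) ℚ.* φ i (suc k)) (trans (ℕP.+-suc i k) (cong suc eq)))) ⟩
  conv (λ i k → K ℚ.* φ i (suc k)) n
    ≡⟨ conv-* K (λ i k → φ i (suc k)) n ⟩
  K ℚ.* conv (λ i k → φ i (suc k)) n
    -- The missing k = 0 term is 0 because `evenMoment 0` is 0, so the sum extends to the full
    -- convolution at n + 1.
    ≡⟨ cong (K ℚ.*_) (sym (trans (conv-last φ n)
         (trans (cong (conv (λ i k → φ i (suc k)) n ℚ.+_) (ℚP.*-zeroʳ (inv! (suc n) ℚ.* (ι 1ℤ ℚ.* inv! 0))))
           (ℚP.+-identityʳ _)))) ⟩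
  K ℚ.* conv φ (suc n)
    ≡⟨ cong (K ℚ.*_) (conv-egf evenMoment (suc n) 0) ⟩
  p ℚ.* ι (- cosℤ (suc n)) ℚ.* (inv! (suc n) ℚ.* ι d)
    ≡⟨ lemma p (ι (- cosℤ (suc n))) (inv! (suc n)) (ι d) ⟩
  p ℚ.* inv! (suc n) ℚ.* (ι (- cosℤ (suc n)) ℚ.* ι d)
    ≡⟨ cong (p ℚ.* inv! (suc n) ℚ.*_) (trans (sym (ι-* (- cosℤ (suc n)) d)) (trans (cong ι signed)
         (trans (ι-* (sinℤ n) (+ 2 * + suc n)) (cong (ι (sinℤ n) ℚ.*_) (ι-* (+ 2) (+ suc n)))))) ⟩
  p ℚ.* inv! (suc n) ℚ.* (ι (sinℤ n) ℚ.* (ι (+ 2) ℚ.* ι (+ suc n)))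
    ≡⟨ lemma′ p (inv! (suc n)) (ι (sinℤ n)) (ι (+ 2)) (ι (+ suc n)) ⟩
  ι (sinℤ n) ℚ.* (p ℚ.* ι (+ 2) ℚ.* (ι (+ suc n) ℚ.* inv! (suc n)))
    ≡⟨ cong₂ (λ x y → ι (sinℤ n) ℚ.* (x ℚ.* y)) halve (suc-inv! n) ⟩
  ι (sinℤ n) ℚ.* (inv (2 ℕ.^ n) ℚ.* inv! n)
    ≡⟨ cong (ι (sinℤ n) ℚ.*_) (sym (inv-* (2 ℕ.^ n) (n !))) ⟩
  ι (sinℤ n) ℚ.* inv (2 ℕ.^ n ℕ.* n !)
    ≡⟨ sym (sinHalf-sinℤ n) ⟩
  sinHalf n ∎
  where
  φ = egf evenMoment 0
  p = inv (2 ℕ.^ suc n)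
  K = p ℚ.* ι (- cosℤ (suc n))
  d = dilate (suc n) evenMoment 0
  signed : - cosℤ (suc n) * d ≡ sinℤ n * (+ 2 * + suc n)
  signed = begin
    - cosℤ (suc n) * d                  ≡⟨ sym (ℤP.neg-distribˡ-* (cosℤ (suc n)) d) ⟩
    - (cosℤ (suc n) * d)                ≡⟨ cong -_ (cosℤ-dilate (suc n)) ⟩
    - (cosℤ (suc n) * (+ 2 * + suc n))  ≡⟨ ℤP.neg-distribˡ-* (cosℤ (suc n)) (+ 2 * + suc n) ⟩
    - cosℤ (suc n) * (+ 2 * + suc n)    ≡⟨ cong (λ x → x * (+ 2 * + suc n))
                                         (trans (cong -_ (cosℤ-suc n)) (ℤP.neg-involutive (sinℤ n))) ⟩
    sinℤ n * (+ 2 * + suc n)           ∎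
  halve : p ℚ.* ι (+ 2) ≡ inv (2 ℕ.^ n)
  halve = trans (cong (λ m → inv (2 ℕ.^ m) ℚ.* ι (+ 2)) (ℕP.+-comm 1 n)) (sym (pow-split n 1))
  lemma : ∀ p x y d → p ℚ.* x ℚ.* (y ℚ.* d) ≡ p ℚ.* y ℚ.* (x ℚ.* d)
  lemma = solveℚ 4 (λ p x y d → p :* x :* (y :* d) := p :* y :* (x :* d)) refl
  lemma′ : ∀ p y x t n → p ℚ.* y ℚ.* (x ℚ.* (t ℚ.* n)) ≡ x ℚ.* (p ℚ.* t ℚ.* (n ℚ.* y))
  lemma′ = solveℚ 5 (λ p y x t n → p :* y :* (x :* (t :* n)) := x :* (p :* t :* (n :* y))) refl

tanHalf-tanCoeff : ∀ n → tanHalf n ≡ tanCoeff n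
tanHalf-tanCoeff n = cong headq (quotRev-unique {τ = tanCoeff} refl conv-cosHalf-tanCoeff n)

genocchi-xTanℤ : ∀ n → genocchi (suc n) ≡ ι (xTanℤ (suc n))
genocchi-xTanℤ n = begin
  ι (fac (suc n)) ℚ.* tanHalf n
    ≡⟨ cong (ι (fac (suc n)) ℚ.*_) (tanHalf-tanCoeff n) ⟩
  ι (fac (suc n)) ℚ.* (ι (xTanℤ (suc n)) ℚ.* inv! (suc n))
    ≡⟨ lemma (ι (fac (suc n))) (ι (xTanℤ (suc n))) (inv! (suc n)) ⟩
  ι (xTanℤ (suc n)) ℚ.* (ι (fac (suc n)) ℚ.* inv! (suc n))
    ≡⟨ cong (ι (xTanℤ (suc n)) ℚ.*_) (fac-inv! (suc n)) ⟩
  ι (xTanℤ (suc n)) ℚ.* 1ℚ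
    ≡⟨ ℚP.*-identityʳ (ι (xTanℤ (suc n))) ⟩
  ι (xTanℤ (suc n)) ∎
  where
  lemma : ∀ x y z → x ℚ.* (y ℚ.* z) ≡ y ℚ.* (x ℚ.* z)
  lemma = solveℚ 3 (λ x y z → x :* (y :* z) := y :* (x :* z)) refl
  fac-inv! : ∀ n → ι (fac n) ℚ.* inv! n ≡ 1ℚ
  fac-inv! n with n ! | ℕP.1≤n! n
  ... | suc m | _ = ι-inv m

-- Genocchi numbers satisfy the recurrence

spread-double : ∀ u m → spread u (double m) ≡ u m
spread-double u zero = refl
spread-double u (suc m) = spread-double (λ k → u (suc k)) m

sgn-square : ∀ n → -1ℤ ^ n * -1ℤ ^ n ≡ 1ℤ
sgn-square zero = refl
sgn-square (suc n) = trans (lemma (-1ℤ ^ n)) (sgn-square n)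
  where
  lemma : ∀ x → -1ℤ * x * (-1ℤ * x) ≡ x * x
  lemma = solve-∀

genocchi-matchings : ∀ n → genocchi (2 ℕ.* n ℕ.+ 4) ≡ ι (matchings n 0)
genocchi-matchings n = begin
  genocchi (2 ℕ.* n ℕ.+ 4)          ≡⟨ cong genocchi (index n) ⟩
  genocchi (double (suc (suc n)))   ≡⟨ genocchi-xTanℤ (suc (double (suc n))) ⟩
  ι (xTanℤ (double (suc (suc n))))  ≡⟨ cong ι xTanℤ≡ ⟩
  ι (matchings n 0)                 ∎
  where
  index : ∀ n → 2 ℕ.* n ℕ.+ 4 ≡ double (suc (suc n))
  index zero = refl
  index (suc n) = trans
    (cong (λ m → suc (m ℕ.+ 4)) (ℕP.+-suc n (n ℕ.+ 0)))
    (cong (λ m → suc (suc m)) (index n))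
  xTanℤ≡ : xTanℤ (double (suc (suc n))) ≡ matchings n 0
  -- `evenMoment` at 2 (n + 2) is `moment (suc n) 0`, which reduces to `moment n 1` since its other
  -- term has the factor 0². The signs (-1)ⁿ⁺² and (-1)ⁿ cancel, as do the two remaining minus
  -- signs.
  xTanℤ≡ = lemma (-1ℤ ^ n) (matchings n 0) (sgn-square n) (cosℤ-double (suc (suc n)))
    (spread-double (shiftedMoment 0) (suc (suc n))) (moment-matchings n 0)
    where
    lemma : ∀ x g {y e m} → x * x ≡ 1ℤ → y ≡ -1ℤ * (-1ℤ * x) → e ≡ m + 0ℤ * m →
      m ≡ x * (-1ℤ * (1ℤ * g)) → - (y * e) ≡ g
    lemma x g eq refl refl refl = begin
      _          ≡⟨ solve (x ∷ g ∷ []) ⟩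
      x * x * g  ≡⟨ cong (_* g) eq ⟩
      1ℤ * g     ≡⟨ ℤP.*-identityˡ g ⟩
      g          ∎

-- Indicators of decidable propositions

indicator : ∀ {p} {P : Set p} → Dec P → ℤ
indicator d = if does d then 1ℤ else 0ℤ

indicator-yes : ∀ {p} {P : Set p} (d : Dec P) → P → indicator d ≡ 1ℤ
indicator-yes (yes _) p = refl
indicator-yes (no ¬p) p = ⊥-elim (¬p p)

indicator-no : ∀ {p} {P : Set p} (d : Dec P) → ¬ P → indicator d ≡ 0ℤ
indicator-no (yes p) ¬p = ⊥-elim (¬p p)
indicator-no (no _)  ¬p = refl

indicator-cong : ∀ {p q} {P : Set p} {Q : Set q} (d : Dec P) (e : Dec Q) →
  (P → Q) → (Q → P) → indicator d ≡ indicator e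
indicator-cong (yes p) e f g = sym (indicator-yes e (f p))
indicator-cong (no ¬p) e f g = sym (indicator-no e (λ q → ¬p (g q)))

Binary : ∀ {A : Set} → (A → ℤ) → Set
Binary f = ∀ x → f x ≡ 0ℤ ⊎ f x ≡ 1ℤ

indicator-binary : ∀ {p} {P : Set p} (d : Dec P) → indicator d ≡ 0ℤ ⊎ indicator d ≡ 1ℤ
indicator-binary (yes _) = inj₂ refl
indicator-binary (no _)  = inj₁ refl

δ : ∀ {N} → Fin N → Fin N → ℤ
δ x y = indicator (x FinP.≟ y)

∑-δ : ∀ {N} (x : Fin N) (f : Fin N → ℤ) → ∑[ y < N ] (δ x y * f y) ≡ f x
∑-δ {suc N} zero f = begin
  1ℤ * f zero + ∑[ y < N ] (0ℤ * f (suc y))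
    ≡⟨ cong₂ _+_ (ℤP.*-identityˡ (f zero)) (sum-cong-≗ (λ y → ℤP.*-zeroˡ (f (suc y)))) ⟩
  f zero + ∑[ y < N ] 0ℤ                     ≡⟨ cong (λ z → f zero + z) (sum-replicate-zero N) ⟩
  f zero + 0ℤ                                ≡⟨ ℤP.+-identityʳ (f zero) ⟩
  f zero                                     ∎
∑-δ {suc N} (suc x) f = begin
  0ℤ * f zero + ∑[ y < N ] (δ x y * f (suc y))  ≡⟨ cong₂ _+_ (ℤP.*-zeroˡ (f zero)) (∑-δ x (λ y → f (suc y))) ⟩
  0ℤ + f (suc x)                                ≡⟨ ℤP.+-identityˡ (f (suc x)) ⟩
  f (suc x)                                     ∎

-- Permanents with weighted columns

Row : ℕ → Set
Row N = Fin N → ℤ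

module _ {N : ℕ} where

  one : Row N
  one _ = 1ℤ

  infixl 6 _∖_
  _∖_ : Row N → Fin N → Row N
  (U ∖ x) y = U y * (1ℤ - δ x y)

  ∖-self : ∀ U {x y} → x ≡ y → (U ∖ x) y ≡ 0ℤ
  ∖-self U {x} {y} x≡y rewrite indicator-yes (x FinP.≟ y) x≡y = ℤP.*-zeroʳ (U y)

  ∖-other : ∀ U {x y} → x ≢ y → (U ∖ x) y ≡ U y
  ∖-other U {x} {y} x≢y rewrite indicator-no (x FinP.≟ y) x≢y = ℤP.*-identityʳ (U y)

  ∖-binary : ∀ {U} → Binary U → ∀ x → Binary (U ∖ x)
  ∖-binary {U} bin x y with x FinP.≟ y
  ... | yes _ = inj₁ (ℤP.*-zeroʳ (U y))
  ... | no _ rewrite ℤP.*-identityʳ (U y) = bin y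

  ∖-comm : ∀ U x y z → (U ∖ x ∖ y) z ≡ (U ∖ y ∖ x) z
  ∖-comm U x y z = lemma (U z) (1ℤ - δ x z) (1ℤ - δ y z)
    where
    lemma : ∀ u a b → u * a * b ≡ u * b * a
    lemma = solve-∀

  δ-sym : ∀ x y → δ {N} x y ≡ δ y x
  δ-sym x y = indicator-cong (x FinP.≟ y) (y FinP.≟ x) sym sym

  -- The permanent of the matrix with the given rows, in the columns weighted by U.
  perm : List (Row N) → Row N → ℤ
  perm [] U = 1ℤ
  perm (A ∷ As) U = ∑[ x < N ] (U x * A x * perm As (U ∖ x))

  perm-congʳ : ∀ As {U V} → (∀ x → U x ≡ V x) → perm As U ≡ perm As V
  perm-congʳ [] eq = refl
  perm-congʳ (A ∷ As) eq = sum-cong-≗ λ x →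
    cong₂ (λ u p → u * A x * p) (eq x) (perm-congʳ As (λ y → cong (_* (1ℤ - δ x y)) (eq y)))

  perm-cong-head : ∀ {A B} As U → (∀ x → A x ≡ B x) → perm (A ∷ As) U ≡ perm (B ∷ As) U
  perm-cong-head As U eq = sum-cong-≗ λ x → cong (λ a → U x * a * perm As (U ∖ x)) (eq x)

  perm-+ : ∀ A B As U → perm ((λ x → A x + B x) ∷ As) U ≡ perm (A ∷ As) U + perm (B ∷ As) U
  perm-+ A B As U = trans
    (sum-cong-≗ λ x → lemma (U x) (A x) (B x) (perm As (U ∖ x)))
    (∑-distrib-+ (λ x → U x * A x * perm As (U ∖ x)) (λ x → U x * B x * perm As (U ∖ x)))
    where
    lemma : ∀ u a b p → u * (a + b) * p ≡ u * a * p + u * b * p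
    lemma = solve-∀

  -- The weight `U x` times `(U ∖ x) y` is symmetric in x and y, so the column sums of the two rows
  -- can be interchanged.
  perm-swap : ∀ A B As U → perm (A ∷ B ∷ As) U ≡ perm (B ∷ A ∷ As) U
  perm-swap A B As U = begin
    ∑[ x < N ] (U x * A x * ∑[ y < N ] (g x y))
      ≡⟨ sum-cong-≗ (λ x → *-distribˡ-sum (U x * A x) (g x)) ⟩
    ∑[ x < N ] ∑[ y < N ] (U x * A x * g x y)
      ≡⟨ ∑-comm (λ x y → U x * A x * g x y) ⟩
    ∑[ y < N ] ∑[ x < N ] (U x * A x * g x y)
      ≡⟨ sum-cong-≗ (λ y → sum-cong-≗ (λ x → exchange x y)) ⟩
    ∑[ y < N ] ∑[ x < N ] (U y * B y * g′ y x)
      ≡⟨ sum-cong-≗ (λ y → sym (*-distribˡ-sum (U y * B y) (g′ y))) ⟩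
    ∑[ y < N ] (U y * B y * ∑[ x < N ] (g′ y x)) ∎
    where
    g g′ : Fin N → Fin N → ℤ
    g x y = (U ∖ x) y * B y * perm As (U ∖ x ∖ y)
    g′ y x = (U ∖ y) x * A x * perm As (U ∖ y ∖ x)
    exchange : ∀ x y → U x * A x * g x y ≡ U y * B y * g′ y x
    exchange x y =
      lemma (U x) (A x) (U y) (B y) (perm As (U ∖ x ∖ y)) (δ x y) (δ-sym y x) (perm-congʳ As (∖-comm U y x))
      where
      lemma : ∀ u a v b p d {d′ p′} → d′ ≡ d → p′ ≡ p →
        u * a * (v * (1ℤ - d) * b * p) ≡ v * b * (u * (1ℤ - d′) * a * p′)
      lemma u a v b p d refl refl = solve (u ∷ a ∷ v ∷ b ∷ p ∷ d ∷ [])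

  perm-↭ : ∀ {As Bs} → As ↭ Bs → ∀ U → perm As U ≡ perm Bs U
  perm-↭ Perm.refl U = refl
  perm-↭ (Perm.prep A p) U = sum-cong-≗ λ x → cong (U x * A x *_) (perm-↭ p (U ∖ x))
  perm-↭ (Perm.swap {As} A B p) U = trans (perm-swap A B As U)
    (sum-cong-≗ λ y → cong (U y * B y *_) (sum-cong-≗ λ x →
      cong ((U ∖ y) x * A x *_) (perm-↭ p (U ∖ y ∖ x))))
  perm-↭ (Perm.trans p q) U = trans (perm-↭ p U) (perm-↭ q U)

  -- Expansion along the first row when the minors agree wherever the weighted entry is nonzero.
  perm-const : ∀ A As U K → (∀ x → U x * A x ≡ 0ℤ ⊎ perm As (U ∖ x) ≡ K) →
    perm (A ∷ As) U ≡ ∑[ x < N ] (U x * A x) * K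
  perm-const A As U K eq = trans (sum-cong-≗ term) (sym (*-distribʳ-sum K (λ x → U x * A x)))
    where
    term : ∀ x → U x * A x * perm As (U ∖ x) ≡ U x * A x * K
    term x with eq x
    ... | inj₁ z rewrite z = trans (ℤP.*-zeroˡ (perm As (U ∖ x))) (sym (ℤP.*-zeroˡ K))
    ... | inj₂ p = cong (U x * A x *_) p

  -- Permanents of nested initial segments

  below : ℕ → Row N
  below t x = indicator (toℕ x ℕP.<? t)

  -- The later counts depend on how many columns below t are free, not on which. Keeping every
  -- column from t on free makes c grow by exactly one when t does.
  record Available (U : Row N) (t c : ℕ) : Set where
    field
      binary : Binary U
      above  : ∀ x → t ≤ toℕ x → U x ≡ 1ℤ
      count  : ∑[ x < N ] (U x * below t x) ≡ + c
  open Available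

  available-one : Available one 0 0
  available-one = record
    { binary = λ _ → inj₂ refl
    ; above = λ _ _ → refl
    ; count = sum-replicate-zero N
    }

  available-suc : ∀ {U t c} → t < N → Available U t c → Available U (suc t) (suc c)
  available-suc {U} {t} {c} t<N av = record
    { binary = binary av
    ; above = λ x t<x → above av x (ℕP.<⇒≤ t<x)
    ; count = begin
        ∑[ x < N ] (U x * below (suc t) x)
          ≡⟨ sum-cong-≗ (λ x → lemma (U x) (below t x) (δ t̂ x) (split x)) ⟩
        ∑[ x < N ] (δ t̂ x * U x + U x * below t x)
          ≡⟨ ∑-distrib-+ (λ x → δ t̂ x * U x) (λ x → U x * below t x) ⟩
        ∑[ x < N ] (δ t̂ x * U x) + ∑[ x < N ] (U x * below t x)
          ≡⟨ cong₂ _+_ (trans (∑-δ t̂ U) (above av t̂ (ℕP.≤-reflexive (sym toℕ-t̂)))) (count av) ⟩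
        1ℤ + + c ∎
    }
    where
    t̂ = fromℕ< t<N
    toℕ-t̂ : toℕ t̂ ≡ t
    toℕ-t̂ = FinP.toℕ-fromℕ< t<N
    split : ∀ x → below (suc t) x ≡ below t x + δ t̂ x
    split x with t̂ FinP.≟ x
    ... | yes refl
      rewrite indicator-yes (toℕ t̂ ℕP.<? suc t) (s≤s (ℕP.≤-reflexive toℕ-t̂))
            | indicator-no (toℕ t̂ ℕP.<? t) (ℕP.<-irrefl toℕ-t̂) = refl
    ... | no t̂≢x = trans
      (indicator-cong (toℕ x ℕP.<? suc t) (toℕ x ℕP.<? t)
        (λ { (s≤s x≤t) → ℕP.≤∧≢⇒< x≤t (λ x≡t → t̂≢x (FinP.toℕ-injective (trans toℕ-t̂ (sym x≡t)))) })
        (λ x<t → ℕP.m≤n⇒m≤1+n x<t))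
      (sym (ℤP.+-identityʳ (below t x)))
    lemma : ∀ u b d {e} → e ≡ b + d → u * e ≡ d * u + u * b
    lemma u b d refl = solve (u ∷ b ∷ d ∷ [])

  available-∖ : ∀ {U t c} x → U x ≡ 1ℤ → toℕ x < t → Available U t (suc c) → Available (U ∖ x) t c
  available-∖ {U} {t} {c} x Ux x<t av = record
    { binary = ∖-binary (binary av) x
    ; above = λ y t≤y → trans
        (∖-other U {x} (λ { refl → ℕP.<-irrefl refl (ℕP.<-≤-trans x<t t≤y) }))
        (above av y t≤y)
    -- Column x contributes exactly 1 to the old count; adding it back to the new one avoids a
    -- subtraction.
    ; count = +-cancelˡ 1ℤ _ _ (begin
        1ℤ + S′
          ≡⟨ cong (_+ S′) (sym (trans (∑-δ x (λ y → U y * below t y))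
               (cong₂ _*_ Ux (indicator-yes (toℕ x ℕP.<? t) x<t)))) ⟩
        ∑[ y < N ] (δ x y * (U y * below t y)) + S′
          ≡⟨ sym (∑-distrib-+ (λ y → δ x y * (U y * below t y)) (λ y → (U ∖ x) y * below t y)) ⟩
        ∑[ y < N ] (δ x y * (U y * below t y) + (U ∖ x) y * below t y)
          ≡⟨ sum-cong-≗ (λ y → lemma (δ x y) (U y) (below t y)) ⟩
        ∑[ y < N ] (U y * below t y)
          ≡⟨ count av ⟩
        1ℤ + + c ∎)
    }
    where
    S′ = ∑[ y < N ] ((U ∖ x) y * below t y)
    lemma : ∀ d u b → d * (u * b) + u * (1ℤ - d) * b ≡ u * b
    lemma = solve-∀

  perm-below : ∀ {U t c} As K → Available U t (suc c) →
    (∀ x → Available (U ∖ x) t c → perm As (U ∖ x) ≡ K) →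
    perm (below t ∷ As) U ≡ + suc c * K
  perm-below {U} {t} {c} As K av eq =
    trans (perm-const (below t) As U K cases) (cong (_* K) (count av))
    where
    cases : ∀ x → U x * below t x ≡ 0ℤ ⊎ perm As (U ∖ x) ≡ K
    cases x with binary av x | toℕ x ℕP.<? t
    ... | inj₁ Ux≡0 | _       rewrite Ux≡0 = inj₁ (ℤP.*-zeroˡ (below t x))
    ... | inj₂ _    | no x≮t  =
      inj₁ (trans (cong (U x *_) (indicator-no (toℕ x ℕP.<? t) x≮t)) (ℤP.*-zeroʳ (U x)))
    ... | inj₂ Ux≡1 | yes x<t = inj₂ (eq x (available-∖ x Ux≡1 x<t av))

  perm-ones : ∀ c {U} → Available U N c → perm (replicate c one) U ≡ fac c
  perm-ones zero av = refl
  perm-ones (suc c) {U} av = begin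
    perm (one ∷ replicate c one) U
      ≡⟨ perm-cong-head (replicate c one) U (λ x → sym (indicator-yes (toℕ x ℕP.<? N) (FinP.toℕ<n x))) ⟩
    perm (below N ∷ replicate c one) U
      ≡⟨ perm-below (replicate c one) (fac c) av (λ x → perm-ones c) ⟩
    + suc c * fac c
      ≡⟨ sym (fac-suc c) ⟩
    fac (suc c) ∎

  interleave : (ℕ → Row N) → (ℕ → Row N) → ℕ → List (Row N)
  interleave lo hi zero = []
  interleave lo hi (suc k) = lo 0 ∷ hi 0 ∷ interleave (λ i → lo (suc i)) (λ i → hi (suc i)) k

  -- Writing hi 0 = one - below (suc t), the k rows lo, the k complements of the rows hi and
  -- the all-one rows are nested, so their permanents count choices from the bottom up.
  perm-interleave : ∀ k {U t c lo hi} → N ≡ suc (double k ℕ.+ t) → Available U t c →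
    (∀ i → i < k → ∀ x → lo i x ≡ below (double (suc i) ℕ.+ t) x) →
    (∀ i x → hi i x + below (suc (double i ℕ.+ t)) x ≡ 1ℤ) →
    perm (interleave lo hi k ++ replicate (suc c) one) U ≡ matchings k c
  perm-interleave zero {U} {t} {c} refl av lo≡ hi≡ =
    perm-ones (suc c) (available-suc ℕP.≤-refl av)
  perm-interleave (suc k) {U} {t} {c} {lo} {hi} N≡ av lo≡ hi≡ = begin
    perm (lo 0 ∷ hi 0 ∷ L) U
      ≡⟨ perm-swap (lo 0) (hi 0) L U ⟩
    perm (hi 0 ∷ lo 0 ∷ L) U
      ≡⟨ lemma (perm (hi 0 ∷ lo 0 ∷ L) U) (perm (below (suc t) ∷ lo 0 ∷ L) U) (+ suc c) (matchings k c)
           (trans (sym (perm-+ (hi 0) (below (suc t)) (lo 0 ∷ L) U))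
             (trans (perm-cong-head (lo 0 ∷ L) U (hi≡ 0)) (perm-swap one (lo 0) L U)))
           full removed ⟩
    + suc (suc c) * matchings k (suc c) - + suc c * + suc c * matchings k c ∎
    where
    L = interleave (λ i → lo (suc i)) (λ i → hi (suc i)) k ++ replicate (suc c) one
    N≡′ : N ≡ suc (double k ℕ.+ suc (suc t))
    N≡′ = trans N≡ (cong suc (sym (trans (ℕP.+-suc (double k) (suc t)) (cong suc (ℕP.+-suc (double k) t)))))
    1+t<N : suc t < N
    1+t<N = ℕP.≤-trans (s≤s (s≤s (ℕP.m≤n⇒m≤1+n (ℕP.m≤n+m t (double k))))) (ℕP.≤-reflexive (sym N≡))
    lo≡′ : ∀ i → i < k → ∀ x → lo (suc i) x ≡ below (double (suc i) ℕ.+ suc (suc t)) x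
    lo≡′ i i<k x = trans (lo≡ (suc i) (s≤s i<k) x) (cong (λ m → below m x)
      (sym (trans (ℕP.+-suc (double (suc i)) (suc t)) (cong suc (ℕP.+-suc (double (suc i)) t)))))
    hi≡′ : ∀ i x → hi (suc i) x + below (suc (double i ℕ.+ suc (suc t))) x ≡ 1ℤ
    hi≡′ i x = trans (cong (λ m → hi (suc i) x + below (suc m) x)
      (trans (ℕP.+-suc (double i) (suc t)) (cong suc (ℕP.+-suc (double i) t)))) (hi≡ (suc i) x)
    -- The row `lo 0` has c + 2 free columns below t + 2; the all-one row in place of `hi 0` then
    -- joins the unrestricted rows.
    full : perm (lo 0 ∷ one ∷ L) U ≡ + suc (suc c) * matchings k (suc c)
    full = trans (perm-cong-head (one ∷ L) U (lo≡ 0 (s≤s z≤n)))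
      (perm-below (one ∷ L) (matchings k (suc c))
        (available-suc 1+t<N (available-suc (ℕP.<⇒≤ 1+t<N) av))
        (λ x av′ → trans
          (perm-↭ (↭-sym (PermP.shift one (interleave (λ i → lo (suc i)) (λ i → hi (suc i)) k)
            (replicate (suc c) one))) (U ∖ x))
          (perm-interleave k N≡′ av′ lo≡′ hi≡′)))
    -- The smaller segment is filled first, in c + 1 ways. One more column lies below t + 2, so
    -- `lo 0` again has c + 1 choices.
    removed : perm (below (suc t) ∷ lo 0 ∷ L) U ≡ + suc c * (+ suc c * matchings k c)
    removed = perm-below (lo 0 ∷ L) (+ suc c * matchings k c)
      (available-suc (ℕP.<⇒≤ 1+t<N) av)
      (λ x av′ → trans (perm-cong-head L (U ∖ x) (lo≡ 0 (s≤s z≤n)))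
        (perm-below L (matchings k c) (available-suc 1+t<N av′)
          (λ y av″ → perm-interleave k N≡′ av″ lo≡′ hi≡′)))
    lemma : ∀ p q x b {r a} → p + q ≡ r → r ≡ a → q ≡ x * (x * b) → p ≡ a - x * x * b
    lemma p q x b refl refl refl = solve (p ∷ x ∷ b ∷ [])

  applyUpTo-interleave : ∀ lo hi k → applyUpTo lo k ++ applyUpTo hi k ↭ interleave lo hi k
  applyUpTo-interleave lo hi zero = Perm.refl
  applyUpTo-interleave lo hi (suc k) = Perm.prep (lo 0) (↭-trans
    (PermP.shift (hi 0) (applyUpTo (λ i → lo (suc i)) k) (applyUpTo (λ i → hi (suc i)) k))
    (Perm.prep (hi 0) (applyUpTo-interleave (λ i → lo (suc i)) (λ i → hi (suc i)) k)))

-- Finite sums over lists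

private
  variable
    X Y : Set

sumL : (X → ℤ) → List X → ℤ
sumL f [] = 0ℤ
sumL f (x ∷ l) = f x + sumL f l

sumL-++ : ∀ (f : X → ℤ) l m → sumL f (l ++ m) ≡ sumL f l + sumL f m
sumL-++ f [] m = sym (ℤP.+-identityˡ (sumL f m))
sumL-++ f (x ∷ l) m = trans (cong (λ z → f x + z) (sumL-++ f l m)) (sym (ℤP.+-assoc (f x) (sumL f l) (sumL f m)))

sumL-map : ∀ (f : Y → ℤ) (g : X → Y) l → sumL f (map g l) ≡ sumL (λ x → f (g x)) l
sumL-map f g [] = refl
sumL-map f g (x ∷ l) = cong (λ z → f (g x) + z) (sumL-map f g l)

sumL-cong : ∀ {f g : X → ℤ} l → (∀ x → f x ≡ g x) → sumL f l ≡ sumL g l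
sumL-cong [] eq = refl
sumL-cong (x ∷ l) eq = cong₂ _+_ (eq x) (sumL-cong l eq)

sumL-concatMap : ∀ (f : Y → ℤ) (g : X → List Y) l →
  sumL f (concatMap g l) ≡ sumL (λ x → sumL f (g x)) l
sumL-concatMap f g [] = refl
sumL-concatMap f g (x ∷ l) =
  trans (sumL-++ f (g x) (concatMap g l)) (cong (λ z → sumL f (g x) + z) (sumL-concatMap f g l))

sumL-* : ∀ a (f : X → ℤ) l → sumL (λ x → a * f x) l ≡ a * sumL f l
sumL-* a f [] = sym (ℤP.*-zeroʳ a)
sumL-* a f (x ∷ l) =
  trans (cong (λ z → a * f x + z) (sumL-* a f l)) (sym (ℤP.*-distribˡ-+ a (f x) (sumL f l)))

sumL-tabulate : ∀ {n} (f : X → ℤ) (g : Fin n → X) → sumL f (tabulate g) ≡ ∑[ i < n ] f (g i)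
sumL-tabulate {n = zero} f g = refl
sumL-tabulate {n = suc n} f g = cong (λ z → f (g zero) + z) (sumL-tabulate f (λ i → g (suc i)))

sumL-∑ : ∀ {n} (f : Fin n → X → ℤ) l →
  sumL (λ x → ∑[ i < n ] f i x) l ≡ ∑[ i < n ] sumL (f i) l
sumL-∑ {n = n} f [] = sym (sum-replicate-zero n)
sumL-∑ {n = n} f (x ∷ l) = trans
  (cong (λ z → ∑[ i < n ] f i x + z) (sumL-∑ f l))
  (sym (∑-distrib-+ (λ i → f i x) (λ i → sumL (f i) l)))

length-filter : ∀ {P : X → Set} (P? : Decidable P) l →
  + length (filter P? l) ≡ sumL (λ x → indicator (P? x)) l
length-filter P? [] = refl
length-filter P? (x ∷ l) with P? x
... | yes _ = cong (λ z → 1ℤ + z) (length-filter P? l)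
... | no _  = trans (length-filter P? l) (sym (ℤP.+-identityˡ _))

-- Counting restricted permutations by a permanent

module _ {N : ℕ} where

  -- One term of the expanded permanent. A repeated entry makes it 0, because `U ∖ x` vanishes at x.
  weight : ∀ {m} → (ℕ → Row N) → Row N → Vec (Fin N) m → ℤ
  weight R U Vec.[] = 1ℤ
  weight R U (x Vec.∷ v) = U x * R 0 x * weight (λ i → R (suc i)) (U ∖ x) v

  -- `allVecs` varies the first entry innermost, whereas the permanent expands along it first, so
  -- the two sums are exchanged.
  sumL-weight : ∀ m R U → sumL (weight R U) (allVecs N m) ≡ perm (applyUpTo R m) U
  sumL-weight zero R U = refl
  sumL-weight (suc m) R U = begin
    sumL (weight R U) (allVecs N (suc m))
      ≡⟨ sumL-concatMap (weight R U) (λ v → map (Vec._∷ v) (allFin N)) (allVecs N m) ⟩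
    sumL (λ v → sumL (weight R U) (map (Vec._∷ v) (allFin N))) (allVecs N m)
      ≡⟨ sumL-cong (allVecs N m) (λ v → trans (sumL-map (weight R U) (Vec._∷ v) (allFin N))
           (sumL-tabulate (λ x → weight R U (x Vec.∷ v)) (λ x → x))) ⟩
    sumL (λ v → ∑[ x < N ] (U x * R 0 x * w x v)) (allVecs N m)
      ≡⟨ sumL-∑ (λ x v → U x * R 0 x * w x v) (allVecs N m) ⟩
    ∑[ x < N ] sumL (λ v → U x * R 0 x * w x v) (allVecs N m)
      ≡⟨ sum-cong-≗ (λ x → trans (sumL-* (U x * R 0 x) (w x) (allVecs N m))
           (cong (U x * R 0 x *_) (sumL-weight m (λ i → R (suc i)) (U ∖ x)))) ⟩
    perm (applyUpTo R (suc m)) U ∎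
    where
    w : Fin N → Vec (Fin N) m → ℤ
    w x = weight (λ i → R (suc i)) (U ∖ x)

  Injective : ∀ {m} → Vec (Fin N) m → Set
  Injective v = ∀ i j → lookup v i ≡ lookup v j → i ≡ j

  Admissible : ∀ {m} → (ℕ → Row N) → Vec (Fin N) m → Set
  Admissible R v = ∀ i → R (toℕ i) (lookup v i) ≡ 1ℤ

  weight≡1 : ∀ {m} R U (v : Vec (Fin N) m) → Injective v → Admissible R v →
    (∀ i → U (lookup v i) ≡ 1ℤ) → weight R U v ≡ 1ℤ
  weight≡1 R U Vec.[] inj adm all = refl
  weight≡1 R U (x Vec.∷ v) inj adm all =
    cong₂ _*_ (cong₂ _*_ (all zero) (adm zero))
      (weight≡1 (λ i → R (suc i)) (U ∖ x) v
        (λ i j eq → FinP.suc-injective (inj (suc i) (suc j) eq))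
        (λ i → adm (suc i))
        (λ i → trans (∖-other U (λ eq → FinP.0≢1+n (inj zero (suc i) eq))) (all (suc i))))

  weight≢0 : ∀ {m} R U (v : Vec (Fin N) m) → (∀ i → Binary (R i)) → Binary U →
    weight R U v ≢ 0ℤ → Injective v × Admissible R v × (∀ i → U (lookup v i) ≡ 1ℤ)
  weight≢0 R U Vec.[] binR binU w≢0 = (λ ()) , (λ ()) , (λ ())
  weight≢0 R U (x Vec.∷ v) binR binU w≢0 with binU x | binR 0 x
  ... | inj₁ Ux≡0 | _ =
    ⊥-elim (w≢0 (cong (λ u → u * R 0 x * weight (λ i → R (suc i)) (U ∖ x) v) Ux≡0))
  ... | inj₂ _ | inj₁ Rx≡0 =
    ⊥-elim (w≢0 (trans (cong (λ r → U x * r * weight (λ i → R (suc i)) (U ∖ x) v) Rx≡0)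
      (cong (_* weight (λ i → R (suc i)) (U ∖ x) v) (ℤP.*-zeroʳ (U x)))))
  ... | inj₂ Ux≡1 | inj₂ Rx≡1
    with weight≢0 (λ i → R (suc i)) (U ∖ x) v (λ i → binR (suc i)) (∖-binary binU x)
           (λ w≡0 → w≢0 (trans (cong (U x * R 0 x *_) w≡0) (ℤP.*-zeroʳ (U x * R 0 x))))
  ... | inj , adm , all =
    (λ { zero zero _ → refl
       ; zero (suc j) eq → ⊥-elim (x∉v j eq)
       ; (suc i) zero eq → ⊥-elim (x∉v i (sym eq))
       ; (suc i) (suc j) eq → cong suc (inj i j eq) })
    , (λ { zero → Rx≡1 ; (suc i) → adm i })
    , (λ { zero → Ux≡1 ; (suc i) → trans (sym (∖-other U (x∉v i))) (all i) })
    where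
    -- A repetition of x would need `U ∖ x` to be 1 at x, where it is 0.
    x∉v : ∀ i → x ≢ lookup v i
    x∉v i eq with trans (sym (∖-self U eq)) (all i)
    ... | ()

  weight-indicator : ∀ {m p} {P : Set p} R (v : Vec (Fin N) m) (d : Dec P) → (∀ i → Binary (R i)) →
    (P → Injective v × Admissible R v) → (Injective v × Admissible R v → P) →
    indicator d ≡ weight R one v
  weight-indicator R v (yes p) binR to from =
    sym (weight≡1 R one v (proj₁ (to p)) (proj₂ (to p)) (λ _ → refl))
  weight-indicator R v (no ¬p) binR to from with weight R one v ℤP.≟ 0ℤ
  ... | yes w≡0 = sym w≡0
  ... | no w≢0 with weight≢0 R one v binR (λ _ → inj₂ refl) w≢0
  ...   | inj , adm , _ = ⊥-elim (¬p (from (inj , adm)))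

  -- position i and value k are 0-indexed
  collapsedAt? : ∀ i k → Dec ((lowerBound N (suc k) ≤ suc i) × (suc i ≤ ⌈ N /2⌉ ℕ.+ ⌊ suc k /2⌋))
  collapsedAt? i k = (lowerBound N (suc k) ℕ.≤? suc i) ×-dec (suc i ℕ.≤? ⌈ N /2⌉ ℕ.+ ⌊ suc k /2⌋)

  collapsedRow : ℕ → Row N
  collapsedRow i x = indicator (collapsedAt? i (toℕ x))

indicator≡1 : ∀ {p} {P : Set p} (d : Dec P) → indicator d ≡ 1ℤ → P
indicator≡1 (yes p) _ = p

numCollapsed-perm : ∀ N → + numCollapsed N ≡ perm {N} (applyUpTo collapsedRow N) one
numCollapsed-perm N = begin
  + numCollapsed N
    ≡⟨ length-filter (λ π → isPerm? π ×-dec collapsed? π) (allVecs N N) ⟩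
  sumL (λ π → indicator (isPerm? π ×-dec collapsed? π)) (allVecs N N)
    ≡⟨ sumL-cong (allVecs N N) (λ π → weight-indicator collapsedRow π (isPerm? π ×-dec collapsed? π)
         (λ i x → indicator-binary (collapsedAt? {N} i (toℕ x)))
         (λ { (inj , col) → inj , λ i → indicator-yes (collapsedAt? (toℕ i) (toℕ (lookup π i))) (col i) })
         (λ { (inj , adm) → inj , λ i → indicator≡1 (collapsedAt? (toℕ i) (toℕ (lookup π i))) (adm i) })) ⟩
  sumL (weight collapsedRow one) (allVecs N N)
    ≡⟨ sumL-weight N collapsedRow one ⟩
  perm (applyUpTo collapsedRow N) one ∎

-- The rows of a collapsed permutation of odd length

≤⌊/2⌋⇒ : ∀ m n → m ≤ ⌊ n /2⌋ → double m ≤ n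
≤⌊/2⌋⇒ zero n p = z≤n
≤⌊/2⌋⇒ (suc m) (suc (suc n)) (s≤s p) = s≤s (s≤s (≤⌊/2⌋⇒ m n p))

-- With the previous lemma this is a Galois connection, which turns the halved bounds into initial
-- segments.
⇒≤⌊/2⌋ : ∀ m n → double m ≤ n → m ≤ ⌊ n /2⌋
⇒≤⌊/2⌋ zero n p = z≤n
⇒≤⌊/2⌋ (suc m) (suc (suc n)) (s≤s (s≤s p)) = s≤s (⇒≤⌊/2⌋ m n p)

lowerBound-odd : ∀ N k → N ℕ.% 2 ≡ 1 → lowerBound N k ≡ ⌈ k /2⌉
lowerBound-odd N k eq with N ℕ.% 2 | eq
... | .1 | refl = refl

odd%2 : ∀ n → suc (double n) ℕ.% 2 ≡ 1
odd%2 zero = refl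
odd%2 (suc n) = odd%2 n

⌊double/2⌋ : ∀ n → ⌊ double n /2⌋ ≡ n
⌊double/2⌋ zero = refl
⌊double/2⌋ (suc n) = cong suc (⌊double/2⌋ n)

module _ (n : ℕ) where

  private
    N : ℕ
    N = suc (double n)

  -- As ⌈(k+1)/2⌉ = 1 + ⌊k/2⌋, the bound on a 0-indexed value k reads ⌊k/2⌋ ≤ i.
  lower⇒ : ∀ i (x : Fin N) → lowerBound N (suc (toℕ x)) ≤ suc i → toℕ x < double (suc i)
  lower⇒ i x p rewrite lowerBound-odd N (suc (toℕ x)) (odd%2 n) =
    ℕP.≰⇒> (λ q → ℕP.<-irrefl refl (ℕP.≤-trans (⇒≤⌊/2⌋ (suc i) (toℕ x) q) (ℕP.≤-pred p)))

  ⇒lower : ∀ i (x : Fin N) → toℕ x < double (suc i) → lowerBound N (suc (toℕ x)) ≤ suc i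
  ⇒lower i x p rewrite lowerBound-odd N (suc (toℕ x)) (odd%2 n) =
    s≤s (ℕP.≮⇒≥ (λ q → ℕP.<-irrefl refl (ℕP.≤-trans p (≤⌊/2⌋⇒ (suc i) (toℕ x) q))))

  -- At 0-indexed position n the bound is already k < 2 (n + 1), which every value meets.
  lower-vacuous : ∀ i (x : Fin N) → n ≤ i → lowerBound N (suc (toℕ x)) ≤ suc i
  lower-vacuous i x n≤i = ℕP.≤-trans
    (⇒lower n x (ℕP.≤-trans (FinP.toℕ<n x) (ℕP.n≤1+n N))) (s≤s n≤i)

  upper-vacuous : ∀ i k → i ≤ n → suc i ≤ ⌈ N /2⌉ ℕ.+ ⌊ k /2⌋
  upper-vacuous i k i≤n rewrite ⌊double/2⌋ n = s≤s (ℕP.≤-trans i≤n (ℕP.m≤m+n n ⌊ k /2⌋))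

  collapsedRow-low : ∀ i → i < n → ∀ x → collapsedRow {N} i x ≡ below (double (suc i) ℕ.+ 0) x
  collapsedRow-low i i<n x rewrite ℕP.+-identityʳ (double i) =
    indicator-cong (collapsedAt? i (toℕ x)) (toℕ x ℕP.<? double (suc i))
      (λ p → lower⇒ i x (proj₁ p))
      (λ p → ⇒lower i x p , upper-vacuous i (suc (toℕ x)) (ℕP.<⇒≤ i<n))

  collapsedRow-mid : ∀ x → collapsedRow {N} (n ℕ.+ 0) x ≡ one x
  collapsedRow-mid x rewrite ℕP.+-identityʳ n =
    indicator-yes (collapsedAt? n (toℕ x))
      (lower-vacuous n x ℕP.≤-refl , upper-vacuous n (suc (toℕ x)) ℕP.≤-refl)

  -- For a 0-indexed value k the upper bound here reads j + 1 ≤ ⌊(k+1)/2⌋, that is 2j + 1 ≤ k.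
  collapsedRow-high : ∀ j x →
    collapsedRow {N} (n ℕ.+ suc j) x + below (suc (double j ℕ.+ 0)) x ≡ 1ℤ
  collapsedRow-high j x rewrite ℕP.+-identityʳ (double j) with toℕ x ℕP.<? suc (double j)
  ... | yes x<  = cong₂ _+_
    (indicator-no (collapsedAt? (n ℕ.+ suc j) (toℕ x))
      (λ p → ℕP.<⇒≱ x< (ℕP.≤-pred (≤⌊/2⌋⇒ (suc j) (suc (toℕ x)) (upper⇒ (proj₂ p))))))
    (indicator-yes (toℕ x ℕP.<? suc (double j)) x<)
    where
    upper⇒ : suc (n ℕ.+ suc j) ≤ ⌈ N /2⌉ ℕ.+ ⌊ suc (toℕ x) /2⌋ → suc j ≤ ⌊ suc (toℕ x) /2⌋
    upper⇒ p rewrite ⌊double/2⌋ n = ℕP.+-cancelˡ-≤ n _ _ (ℕP.≤-pred p)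
  ... | no x≮ = cong₂ _+_
    (indicator-yes (collapsedAt? (n ℕ.+ suc j) (toℕ x))
      (lower-vacuous (n ℕ.+ suc j) x (ℕP.m≤m+n n (suc j)) ,
       ⇒upper (⇒≤⌊/2⌋ (suc j) (suc (toℕ x)) (s≤s (ℕP.≮⇒≥ x≮)))))
    (indicator-no (toℕ x ℕP.<? suc (double j)) x≮)
    where
    ⇒upper : suc j ≤ ⌊ suc (toℕ x) /2⌋ → suc (n ℕ.+ suc j) ≤ ⌈ N /2⌉ ℕ.+ ⌊ suc (toℕ x) /2⌋
    ⇒upper p rewrite ⌊double/2⌋ n = s≤s (ℕP.+-monoʳ-≤ n p)

-- Assembling the count for N = 2n + 1

applyUpTo-++ : ∀ (f : ℕ → X) m n →
  applyUpTo f (m ℕ.+ n) ≡ applyUpTo f m ++ applyUpTo (λ i → f (m ℕ.+ i)) n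
applyUpTo-++ f zero n = refl
applyUpTo-++ f (suc m) n = cong (f 0 ∷_) (applyUpTo-++ (λ i → f (suc i)) m n)

suc-double : ∀ n → suc (double n) ≡ n ℕ.+ suc n
suc-double zero = refl
suc-double (suc n) = cong suc (trans (cong suc (suc-double n)) (sym (ℕP.+-suc n (suc n))))

numCollapsed-matchings : ∀ n → + numCollapsed (suc (double n)) ≡ matchings n 0
numCollapsed-matchings n = begin
  + numCollapsed N
    ≡⟨ numCollapsed-perm N ⟩
  perm (applyUpTo R N) one
    ≡⟨ cong (λ l → perm l one) (trans (cong (applyUpTo R) (suc-double n)) (applyUpTo-++ R n (suc n))) ⟩
  perm (applyUpTo R n ++ R (n ℕ.+ 0) ∷ applyUpTo hi n) one
    ≡⟨ perm-↭ (PermP.shift (R (n ℕ.+ 0)) (applyUpTo R n) (applyUpTo hi n)) one ⟩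
  perm (R (n ℕ.+ 0) ∷ applyUpTo R n ++ applyUpTo hi n) one
    ≡⟨ perm-cong-head (applyUpTo R n ++ applyUpTo hi n) one (collapsedRow-mid n) ⟩
  perm (one ∷ applyUpTo R n ++ applyUpTo hi n) one
    -- The middle row goes to the end, as the single unrestricted row present when c = 0.
    ≡⟨ perm-↭ (↭-trans (Perm.prep one (applyUpTo-interleave R hi n)) (PermP.∷↭∷ʳ one (interleave R hi n))) one ⟩
  perm (interleave R hi n ++ one ∷ []) one
    ≡⟨ perm-interleave n (cong suc (sym (ℕP.+-identityʳ (double n)))) available-one
         (collapsedRow-low n) (collapsedRow-high n) ⟩
  matchings n 0 ∎
  where
  N = suc (double n)
  R hi : ℕ → Row N
  R = collapsedRow
  hi i = R (n ℕ.+ suc i)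

theorem4p2 : (n : ℕ) → n ℕ.≥ 1 →
    (+ numCollapsed (2 ℕ.* n ℕ.+ 1)) / 1 ≡ genocchi (2 ℕ.* n ℕ.+ 4)
theorem4p2 n _ = begin
  ι (+ numCollapsed (2 ℕ.* n ℕ.+ 1))   ≡⟨ cong (λ N → ι (+ numCollapsed N)) 2n+1≡ ⟩
  ι (+ numCollapsed (suc (double n)))  ≡⟨ cong ι (numCollapsed-matchings n) ⟩
  ι (matchings n 0)                    ≡⟨ sym (genocchi-matchings n) ⟩
  genocchi (2 ℕ.* n ℕ.+ 4)             ∎
  where
  2n+1≡ : 2 ℕ.* n ℕ.+ 1 ≡ suc (double n)
  2n+1≡ = trans (ℕP.+-comm (2 ℕ.* n) 1)
    (trans (sym (ℕP.+-suc n (n ℕ.+ 0))) (trans (cong (λ m → n ℕ.+ suc m) (ℕP.+-identityʳ n)) (sym (suc-double n))))
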